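{- Let $0<\epsilon<\frac12$. Every $n$-vertex digraph $G$ with minimum outdegree at least $$2\epsilon^{ -2}(2-\epsilon)\log\left(\frac{1-\epsilon}{\epsilon}\right)$$ contains a stable set of at least $\left(\frac12-\epsilon\right)n$ vertices.
   Context: Digraphs are finite, with no loops and no parallel arcs (a pair of oppositely directed arcs $uv$ and $vu$ is allowed). $\log$ denotes the natural logarithm. A set $T$ of vertices in a digraph $G$ is a stable set if for each vertex $v\in T$, at most half the out-neighbours of $v$ (in $G$) are also in $T$. (This is not the usual notion of an independent set.) -}

module Defs where

open import Data.Bool.Base using (Bool; true; false; if_then_else_)
open import Data.Fin.Base using (Fin)
open import Data.Fin.Subset using (Subset; _∈_; _∉_; _∩_; ∣_∣)
open import Data.Integer.Base as ℤ using (ℤ; +_; -[1+_])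
import Data.Integer.Properties as ℤₚ
open import Data.Nat.Base as ℕ using (ℕ; zero; suc)
import Data.Nat.Properties as ℕₚ
open import Data.Product.Base using (∃; _×_; _,_; proj₁; proj₂)
open import Data.Rational.Base renaming (∣_∣ to abs)
open import Data.Rational.Properties
open import Data.Rational.Solver
import Data.Rational.Unnormalised.Base as ℚᵘ
import Data.Rational.Unnormalised.Properties as ℚᵘₚ
open import Data.Sum.Base using (_⊎_; inj₁; inj₂)
open import Function.Base using (_∘_)
open import Relation.Binary.PropositionalEquality
open import Relation.Nullary using (¬_; Dec; does; yes; no; contradiction)
open import Relation.Nullary.Decidable using (dec-true)
open +-*-Solver

ι : ℕ → ℚ
ι n = + n / 1

1/1+ : ℕ → ℚ
1/1+ n = + 1 / suc n

ι-suc : ∀ n → ι (suc n) ≡ ι n + 1ℚ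
ι-suc n = toℚᵘ-injective (begin
  toℚᵘ (ι (suc n)) ≈⟨ toℚᵘ-fromℚᵘ (ℚᵘ.mkℚᵘ (+ suc n) 0) ⟩
  ℚᵘ.mkℚᵘ (+ suc n) 0 ≈⟨ ℚᵘ.*≡* (cong (ℤ._* + 1) (lem n)) ⟩
  ℚᵘ.mkℚᵘ (+ n) 0 ℚᵘ.+ toℚᵘ 1ℚ ≈⟨ ℚᵘₚ.+-congˡ (toℚᵘ 1ℚ) (ℚᵘₚ.≃-sym (toℚᵘ-fromℚᵘ (ℚᵘ.mkℚᵘ (+ n) 0))) ⟩
  toℚᵘ (ι n) ℚᵘ.+ toℚᵘ 1ℚ ≈⟨ ℚᵘₚ.≃-sym (toℚᵘ-homo-+ (ι n) 1ℚ) ⟩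
  toℚᵘ (ι n + 1ℚ) ∎)
  where
    open ℚᵘₚ.≃-Reasoning
    lem : ∀ n → + suc n ≡ + n ℤ.* + 1 ℤ.+ + 1
    lem n = trans (cong +_ (ℕₚ.+-comm 1 n)) (cong (ℤ._+ + 1) (sym (ℤₚ.*-identityʳ (+ n))))

ι-1/1+ : ∀ n → ι (suc n) * 1/1+ n ≡ 1ℚ
ι-1/1+ n = toℚᵘ-injective (begin
  toℚᵘ (ι (suc n) * 1/1+ n) ≈⟨ toℚᵘ-homo-* (ι (suc n)) (1/1+ n) ⟩
  toℚᵘ (ι (suc n)) ℚᵘ.* toℚᵘ (1/1+ n) ≈⟨ ℚᵘₚ.*-cong (toℚᵘ-fromℚᵘ (ℚᵘ.mkℚᵘ (+ suc n) 0)) (toℚᵘ-fromℚᵘ (ℚᵘ.mkℚᵘ (+ 1) n)) ⟩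
  ℚᵘ.mkℚᵘ (+ suc n) 0 ℚᵘ.* ℚᵘ.mkℚᵘ (+ 1) n ≈⟨ ℚᵘ.*≡* (cong +_ (lem n)) ⟩
  toℚᵘ 1ℚ ∎)
  where
    open ℚᵘₚ.≃-Reasoning
    lem : ∀ n → suc n ℕ.* 1 ℕ.* 1 ≡ suc (n ℕ.+ 0 ℕ.+ 0)
    lem n = trans (ℕₚ.*-identityʳ (suc n ℕ.* 1)) (trans (ℕₚ.*-identityʳ (suc n)) (cong suc (sym (trans (ℕₚ.+-identityʳ _) (ℕₚ.+-identityʳ n)))))

≤ι : ∀ p → p ≤ ι ℤ.∣ ↥ p ∣
≤ι p@(mkℚ a d c) = toℚᵘ-cancel-≤ (ℚᵘₚ.≤-respʳ-≃ (ℚᵘₚ.≃-sym (toℚᵘ-fromℚᵘ (ℚᵘ.mkℚᵘ (+ ℤ.∣ a ∣) 0))) (ℚᵘ.*≤* (lem a)))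
  where
    lem : ∀ a → a ℤ.* + 1 ℤ.≤ + ℤ.∣ a ∣ ℤ.* + suc d
    lem (+ n) = subst₂ ℤ._≤_ (ℤₚ.pos-* n 1) (ℤₚ.pos-* n (suc d)) (ℤ.+≤+ (ℕₚ.*-monoʳ-≤ n (ℕ.s≤s ℕ.z≤n)))
    lem -[1+ n ] = ℤ.-≤+

by : ∀ {a b c d} → a ≤ b → d + a ≡ c + b → c ≤ d
by {a} {b} {c} {d} a≤b e = begin
  c            ≡⟨ solve 2 (λ c a → c := (c :+ a) :- a) refl c a ⟩
  (c + a) - a  ≤⟨ +-monoˡ-≤ (- a) (+-monoʳ-≤ c a≤b) ⟩
  (c + b) - a  ≡⟨ cong (_- a) e ⟨
  (d + a) - a  ≡⟨ solve 2 (λ d a → (d :+ a) :- a := d) refl d a ⟩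
  d            ∎
  where open ≤-Reasoning

infixr 5 _⊞_
_⊞_ : ∀ {a b c d} → a ≤ b → c ≤ d → a + c ≤ b + d
_⊞_ = +-mono-≤

infixr 8 _⊡_
_⊡_ : ∀ {c a b} → 0ℚ ≤ c → a ≤ b → c * a ≤ c * b
_⊡_ {c} 0≤c a≤b = *-monoˡ-≤-nonNeg c {{nonNegative 0≤c}} a≤b

0≤* : ∀ {p q} → 0ℚ ≤ p → 0ℚ ≤ q → 0ℚ ≤ p * q
0≤* {p} {q} 0≤p 0≤q = subst (_≤ p * q) (*-zeroʳ p) (0≤p ⊡ 0≤q)

0<* : ∀ {p q} → 0ℚ < p → 0ℚ < q → 0ℚ < p * q
0<* {p} {q} 0<p 0<q = positive⁻¹ (p * q) {{pos*pos⇒pos p {{positive 0<p}} q {{positive 0<q}}}}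

0<+ : ∀ {p q} → 0ℚ < p → 0ℚ < q → 0ℚ < p + q
0<+ 0<p 0<q = +-mono-< 0<p 0<q

*-mono : ∀ {a b c d} → 0ℚ ≤ a → 0ℚ ≤ d → a ≤ b → c ≤ d → a * c ≤ b * d
*-mono {a} {b} {c} {d} 0≤a 0≤d a≤b c≤d =
  ≤-trans (0≤a ⊡ c≤d) (*-monoʳ-≤-nonNeg d {{nonNegative 0≤d}} a≤b)

p≤∣p∣ : ∀ p → p ≤ abs p
p≤∣p∣ p with ≤-total 0ℚ p
... | inj₁ 0≤p = ≤-reflexive (sym (0≤p⇒∣p∣≡p 0≤p))
... | inj₂ p≤0 = ≤-trans p≤0 (0≤∣p∣ p)

-p≤∣p∣ : ∀ p → - p ≤ abs p
-p≤∣p∣ p = subst (- p ≤_) (∣-p∣≡∣p∣ p) (p≤∣p∣ (- p))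

∣p∣≤ : ∀ {p q} → p ≤ q → - p ≤ q → abs p ≤ q
∣p∣≤ {p} p≤q -p≤q with ∣p∣≡p∨∣p∣≡-p p
... | inj₁ e = ≤-trans (≤-reflexive e) p≤q
... | inj₂ e = ≤-trans (≤-reflexive e) -p≤q

0<½ : 0ℚ < ½
0<½ = positive⁻¹ ½

0≤1 : 0ℚ ≤ 1ℚ
0≤1 = <⇒≤ (positive⁻¹ 1ℚ)

0<½* : ∀ {δ} → 0ℚ < δ → 0ℚ < ½ * δ
0<½* = 0<* 0<½

½+½ : ∀ δ → ½ * δ + ½ * δ ≡ δ
½+½ = solve 1 (λ δ → con ½ :* δ :+ con ½ :* δ := δ) refl

0<1/1+ : ∀ n → 0ℚ < 1/1+ n
0<1/1+ n = positive⁻¹ (1/1+ n) {{normalize-pos 1 (suc n)}}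

0≤1/1+ : ∀ n → 0ℚ ≤ 1/1+ n
0≤1/1+ n = <⇒≤ (0<1/1+ n)

ι-+ : ∀ m n → ι (m ℕ.+ n) ≡ ι m + ι n
ι-+ zero    n = sym (+-identityˡ (ι n))
ι-+ (suc m) n = begin
  ι (suc (m ℕ.+ n))  ≡⟨ ι-suc (m ℕ.+ n) ⟩
  ι (m ℕ.+ n) + 1ℚ   ≡⟨ cong (_+ 1ℚ) (ι-+ m n) ⟩
  ι m + ι n + 1ℚ     ≡⟨ solve 3 (λ a b c → a :+ b :+ c := a :+ c :+ b) refl (ι m) (ι n) 1ℚ ⟩
  ι m + 1ℚ + ι n     ≡⟨ cong (_+ ι n) (ι-suc m) ⟨
  ι (suc m) + ι n    ∎
  where open ≡-Reasoning

ι-* : ∀ m n → ι (m ℕ.* n) ≡ ι m * ι n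
ι-* zero    n = sym (*-zeroˡ (ι n))
ι-* (suc m) n = begin
  ι (n ℕ.+ m ℕ.* n)  ≡⟨ ι-+ n (m ℕ.* n) ⟩
  ι n + ι (m ℕ.* n)  ≡⟨ cong (λ z → ι n + z) (ι-* m n) ⟩
  ι n + ι m * ι n    ≡⟨ solve 2 (λ m n → n :+ m :* n := (m :+ con 1ℚ) :* n) refl (ι m) (ι n) ⟩
  (ι m + 1ℚ) * ι n   ≡⟨ cong (_* ι n) (ι-suc m) ⟨
  ι (suc m) * ι n    ∎
  where open ≡-Reasoning

0≤ι : ∀ n → 0ℚ ≤ ι n
0≤ι zero    = ≤-refl
0≤ι (suc n) = subst (0ℚ ≤_) (sym (ι-suc n)) (0≤ι n ⊞ 0≤1)

ι-mono : ∀ {m n} → m ℕ.≤ n → ι m ≤ ι n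
ι-mono {m} {n} m≤n = subst (ι m ≤_) (trans (sym (ι-+ m (n ℕ.∸ m))) (cong ι (ℕₚ.m+[n∸m]≡n m≤n)))
  (by (0≤ι (n ℕ.∸ m)) (solve 2 (λ a b → a :+ b :+ con 0ℚ := a :+ b) refl (ι m) (ι (n ℕ.∸ m))))

-- 1/p for p ≠ 0; the value at 0 is irrelevant
recip : ℚ → ℚ
recip p with p ≟ 0ℚ
... | yes _  = 0ℚ
... | no p≢0 = (1/ p) {{≢-nonZero p≢0}}

recip-inverse : ∀ {p} → 0ℚ < p → p * recip p ≡ 1ℚ
recip-inverse {p} 0<p with p ≟ 0ℚ
... | yes p≡0 = contradiction (sym p≡0) (<⇒≢ 0<p)
... | no p≢0  = *-inverseʳ p {{≢-nonZero p≢0}}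

0<recip : ∀ {p} → 0ℚ < p → 0ℚ < recip p
0<recip {p} 0<p with p ≟ 0ℚ
... | yes p≡0 = contradiction (sym p≡0) (<⇒≢ 0<p)
... | no p≢0  = positive⁻¹ ((1/ p) {{≢-nonZero p≢0}}) {{1/pos⇒pos p {{positive 0<p}}}}

archimedean : ∀ p {δ} → 0ℚ < δ → ∃ λ N → ∀ n → N ℕ.≤ n → p * 1/1+ n ≤ δ
archimedean p {δ} 0<δ = N , λ n N≤n →
  let h₁ : p * recip δ ≤ ι (suc n)
      h₁ = ≤-trans (≤ι (p * recip δ)) (ι-mono (ℕₚ.m≤n⇒m≤1+n N≤n))
      h₂ : p ≤ δ * ι (suc n)
      h₂ = subst (_≤ δ * ι (suc n)) (e p δ (recip δ) (recip-inverse 0<δ)) (<⇒≤ 0<δ ⊡ h₁)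
      h₃ : p * 1/1+ n ≤ δ * ι (suc n) * 1/1+ n
      h₃ = *-monoʳ-≤-nonNeg (1/1+ n) {{nonNegative (0≤1/1+ n)}} h₂
  in subst (p * 1/1+ n ≤_) (trans (*-assoc δ (ι (suc n)) (1/1+ n)) (trans (cong (δ *_) (ι-1/1+ n)) (*-identityʳ δ))) h₃
  where
    N : ℕ
    N = ℤ.∣ ↥ (p * recip δ) ∣
    e : ∀ p δ r → δ * r ≡ 1ℚ → δ * (p * r) ≡ p
    e p δ r h = trans (solve 3 (λ p δ r → δ :* (p :* r) := δ :* r :* p) refl p δ r)
                      (trans (cong (_* p) h) (*-identityˡ p))

-- expTerm q k = qᵏ / k! and expSum q n = Σ_{k ≤ n} qᵏ / k!
expTerm : ℚ → ℕ → ℚ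
expTerm q zero    = 1ℚ
expTerm q (suc k) = expTerm q k * (q * 1/1+ k)

expSum : ℚ → ℕ → ℚ
expSum q zero    = 1ℚ
expSum q (suc n) = expSum q n + expTerm q (suc n)

0≤expTerm : ∀ {q} → 0ℚ ≤ q → ∀ k → 0ℚ ≤ expTerm q k
0≤expTerm 0≤q zero    = 0≤1
0≤expTerm 0≤q (suc k) = 0≤* (0≤expTerm 0≤q k) (0≤* 0≤q (0≤1/1+ k))

expTerm-mono : ∀ {p q} → 0ℚ ≤ p → p ≤ q → ∀ k → expTerm p k ≤ expTerm q k
expTerm-mono 0≤p p≤q zero    = ≤-refl
expTerm-mono 0≤p p≤q (suc k) =
  *-mono (0≤expTerm 0≤p k) (0≤* 0≤q (0≤1/1+ k)) (expTerm-mono 0≤p p≤q k)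
    (*-mono 0≤p (0≤1/1+ k) p≤q ≤-refl)
  where 0≤q = ≤-trans 0≤p p≤q

expSum-mono : ∀ {p q} → 0ℚ ≤ p → p ≤ q → ∀ n → expSum p n ≤ expSum q n
expSum-mono 0≤p p≤q zero    = ≤-refl
expSum-mono 0≤p p≤q (suc n) = expSum-mono 0≤p p≤q n ⊞ expTerm-mono 0≤p p≤q (suc n)

expSum-monoⁿ : ∀ {q} → 0ℚ ≤ q → ∀ {m n} → m ℕ.≤ n → expSum q m ≤ expSum q n
expSum-monoⁿ {q} 0≤q m≤n = go (ℕₚ.≤⇒≤′ m≤n)
  where
    go : ∀ {m n} → m ℕ.≤′ n → expSum q m ≤ expSum q n
    go (ℕ.≤′-reflexive refl) = ≤-refl
    go (ℕ.≤′-step {n} m≤′n)  = ≤-trans (go m≤′n)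
      (by (0≤expTerm 0≤q (suc n))
          (solve 2 (λ a b → a :+ b :+ con 0ℚ := a :+ b) refl (expSum q n) (expTerm q (suc n))))

0≤expSum : ∀ {q} → 0ℚ ≤ q → ∀ n → 0ℚ ≤ expSum q n
0≤expSum 0≤q n = ≤-trans 0≤1 (expSum-monoⁿ 0≤q {0} {n} ℕ.z≤n)

expSum-growth : ∀ {p q} → 0ℚ ≤ p → p ≤ q → ∀ n → expSum p (suc n) + (q - p) ≤ expSum q (suc n)
expSum-growth {p} {q} 0≤p p≤q zero =
  ≤-reflexive (solve 2 (λ p q → con 1ℚ :+ con 1ℚ :* (p :* con 1ℚ) :+ (q :- p) := con 1ℚ :+ con 1ℚ :* (q :* con 1ℚ)) refl p q)
expSum-growth {p} {q} 0≤p p≤q (suc n) =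
  by (expSum-growth 0≤p p≤q n ⊞ expTerm-mono 0≤p p≤q (suc (suc n)))
     (solve 5 (λ Ep Eq tp tq d → (Eq :+ tq) :+ ((Ep :+ d) :+ tp) := (Ep :+ tp :+ d) :+ (Eq :+ tq)) refl
       (expSum p (suc n)) (expSum q (suc n)) (expTerm p (suc (suc n))) (expTerm q (suc (suc n))) (q - p))

1+q≤expSum : ∀ {q} → 0ℚ ≤ q → ∀ n → 1ℚ + q ≤ expSum q (suc n)
1+q≤expSum {q} 0≤q n =
  by (expSum-growth ≤-refl 0≤q n ⊞ expSum-monoⁿ ≤-refl {0} {suc n} ℕ.z≤n)
     (solve 3 (λ E0 Eq q → Eq :+ (E0 :+ (q :- con 0ℚ) :+ con 1ℚ) := (con 1ℚ :+ q) :+ (Eq :+ E0)) refl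
       (expSum 0ℚ (suc n)) (expSum q (suc n)) q)

expSum-0 : ∀ n → expSum 0ℚ n ≡ 1ℚ
expSum-0 zero    = refl
expSum-0 (suc n) = trans (cong₂ _+_ (expSum-0 n) (solve 2 (λ t u → t :* (con 0ℚ :* u) := con 0ℚ) refl (expTerm 0ℚ n) (1/1+ n))) refl

expTerm-half : ∀ b {q} → 0ℚ ≤ q → q ≤ ι b → ∀ k → b ℕ.+ b ℕ.≤ k → expTerm q (suc k) ≤ expTerm q k * ½
expTerm-half b {q} 0≤q q≤b k 2b≤k = 0≤expTerm 0≤q k ⊡ lem
  where
    u = 1/1+ k
    2q≤ : q + q ≤ ι (suc k)
    2q≤ = ≤-trans (q≤b ⊞ q≤b) (≤-trans (≤-reflexive (sym (ι-+ b b))) (ι-mono (ℕₚ.m≤n⇒m≤1+n 2b≤k)))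
    h : (q + q) * u ≤ 1ℚ
    h = ≤-trans (*-monoʳ-≤-nonNeg u {{nonNegative (0≤1/1+ k)}} 2q≤) (≤-reflexive (ι-1/1+ k))
    lem : q * u ≤ ½
    lem = by (<⇒≤ 0<½ ⊡ h) (solve 2 (λ q u → con ½ :+ con ½ :* ((q :+ q) :* u) := q :* u :+ con ½ :* con 1ℚ) refl q u)

expTerm-decr : ∀ b {q} → 0ℚ ≤ q → q ≤ ι b → ∀ {m n} → b ℕ.+ b ℕ.≤ m → m ℕ.≤ n →
               expSum q n + expTerm q n ≤ expSum q m + expTerm q m × expTerm q n ≤ expTerm q m
expTerm-decr b {q} 0≤q q≤b 2b≤m m≤n = go 2b≤m (ℕₚ.≤⇒≤′ m≤n)
  where
    go : ∀ {m n} → b ℕ.+ b ℕ.≤ m → m ℕ.≤′ n →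
         expSum q n + expTerm q n ≤ expSum q m + expTerm q m × expTerm q n ≤ expTerm q m
    go 2b≤m (ℕ.≤′-reflexive refl) = ≤-refl , ≤-refl
    go {m} 2b≤m (ℕ.≤′-step {n} m≤′n) with go 2b≤m m≤′n
    ... | h₁ , h₂ =
      by (h₁ ⊞ (half ⊞ half))
         (solve 4 (λ R En tn t′ → R :+ ((En :+ tn) :+ (t′ :+ t′)) := (En :+ t′ :+ t′) :+ (R :+ (tn :* con ½ :+ tn :* con ½))) refl
           (expSum q m + expTerm q m) (expSum q n) (expTerm q n) (expTerm q (suc n)))
      , ≤-trans half (≤-trans (by (<⇒≤ 0<½ ⊡ 0≤expTerm 0≤q n) (solve 1 (λ t → t :+ con ½ :* con 0ℚ := t :* con ½ :+ con ½ :* t) refl (expTerm q n))) h₂)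
      where
        half : expTerm q (suc n) ≤ expTerm q n * ½
        half = expTerm-half b 0≤q q≤b n (ℕₚ.≤-trans 2b≤m (ℕₚ.≤′⇒≤ m≤′n))

expTerm→0 : ∀ b {δ} → 0ℚ < δ → ∃ λ N → ∀ n → N ℕ.≤ n → expTerm (ι b) n ≤ δ
expTerm→0 b {δ} 0<δ = suc (N₁ ℕ.⊔ (b ℕ.+ b)) , λ { (suc n) (ℕ.s≤s N≤n) → begin
  expTerm (ι b) n * (ι b * 1/1+ n)
    ≤⟨ *-monoʳ-≤-nonNeg (ι b * 1/1+ n) {{nonNegative (0≤* (0≤ι b) (0≤1/1+ n))}}
         (proj₂ (expTerm-decr b (0≤ι b) ≤-refl ℕₚ.≤-refl (ℕₚ.≤-trans (ℕₚ.m≤n⊔m N₁ (b ℕ.+ b)) N≤n))) ⟩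
  expTerm (ι b) (b ℕ.+ b) * (ι b * 1/1+ n)
    ≡⟨ *-assoc (expTerm (ι b) (b ℕ.+ b)) (ι b) (1/1+ n) ⟨
  expTerm (ι b) (b ℕ.+ b) * ι b * 1/1+ n
    ≤⟨ proj₂ arch n (ℕₚ.≤-trans (ℕₚ.m≤m⊔n N₁ (b ℕ.+ b)) N≤n) ⟩
  δ ∎ }
  where
    open ≤-Reasoning
    arch = archimedean (expTerm (ι b) (b ℕ.+ b) * ι b) 0<δ
    N₁ = proj₁ arch

expSum-tail : ∀ b {δ} → 0ℚ < δ → ∃ λ N → ∀ n → N ℕ.≤ n → ∀ m {q} → 0ℚ ≤ q → q ≤ ι b →
              expSum q m ≤ expSum q n + δ
expSum-tail b {δ} 0<δ = N₁ ℕ.⊔ (b ℕ.+ b) , tail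
  where
    N₁ = proj₁ (expTerm→0 b 0<δ)
    small = proj₂ (expTerm→0 b 0<δ)
    tail : ∀ n → N₁ ℕ.⊔ (b ℕ.+ b) ℕ.≤ n → ∀ m {q} → 0ℚ ≤ q → q ≤ ι b → expSum q m ≤ expSum q n + δ
    tail n N≤n m {q} 0≤q q≤b with ℕₚ.≤-total m n
    ... | inj₁ m≤n = by (expSum-monoⁿ 0≤q m≤n ⊞ <⇒≤ 0<δ)
            (solve 3 (λ a b d → (b :+ d) :+ (a :+ con 0ℚ) := a :+ (b :+ d)) refl (expSum q m) (expSum q n) δ)
    ... | inj₂ n≤m = by
            (proj₁ (expTerm-decr b 0≤q q≤b (ℕₚ.≤-trans (ℕₚ.m≤n⊔m N₁ (b ℕ.+ b)) N≤n) n≤m)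
              ⊞ (0≤expTerm 0≤q m ⊞ ≤-trans (expTerm-mono 0≤q q≤b n) (small n (ℕₚ.≤-trans (ℕₚ.m≤m⊔n N₁ (b ℕ.+ b)) N≤n))))
            (solve 5 (λ Em tm En tn d → (En :+ d) :+ ((Em :+ tm) :+ (con 0ℚ :+ tn)) := Em :+ ((En :+ tn) :+ (tm :+ d))) refl
              (expSum q m) (expTerm q m) (expSum q n) (expTerm q n) δ)

expSum-bound : ∀ b → ∃ λ C → ∀ n → expSum (ι b) n ≤ C
expSum-bound b =
  let (N , tail) = expSum-tail b (positive⁻¹ 1ℚ)
  in expSum (ι b) N + 1ℚ , λ n → tail N ℕₚ.≤-refl n (0≤ι b) ≤-refl

∣expTerm∣ : ∀ q k → abs (expTerm q k) ≡ expTerm (abs q) k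
∣expTerm∣ q zero    = refl
∣expTerm∣ q (suc k) = begin
  abs (expTerm q k * (q * 1/1+ k))        ≡⟨ ∣p*q∣≡∣p∣*∣q∣ (expTerm q k) (q * 1/1+ k) ⟩
  abs (expTerm q k) * abs (q * 1/1+ k)      ≡⟨ cong₂ _*_ (∣expTerm∣ q k) (∣p*q∣≡∣p∣*∣q∣ q (1/1+ k)) ⟩
  expTerm (abs q) k * (abs q * abs (1/1+ k)) ≡⟨ cong (λ z → expTerm (abs q) k * (abs q * z)) (0≤p⇒∣p∣≡p (0≤1/1+ k)) ⟩
  expTerm (abs q) k * (abs q * 1/1+ k)    ∎
  where open ≡-Reasoning

∣expSum-diff∣ : ∀ q {m n} → m ℕ.≤ n → abs (expSum q n - expSum q m) ≤ expSum (abs q) n - expSum (abs q) m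
∣expSum-diff∣ q m≤n = go (ℕₚ.≤⇒≤′ m≤n)
  where
    go : ∀ {m n} → m ℕ.≤′ n → abs (expSum q n - expSum q m) ≤ expSum (abs q) n - expSum (abs q) m
    go {m} (ℕ.≤′-reflexive refl) = ≤-reflexive (trans (cong abs (+-inverseʳ (expSum q m))) (sym (+-inverseʳ (expSum (abs q) m))))
    go {m} (ℕ.≤′-step {n} m≤′n) = begin
      abs (expSum q n + t - expSum q m)
        ≡⟨ cong abs (solve 3 (λ a t b → a :+ t :- b := (a :- b) :+ t) refl (expSum q n) t (expSum q m)) ⟩
      abs ((expSum q n - expSum q m) + t)
        ≤⟨ ∣p+q∣≤∣p∣+∣q∣ (expSum q n - expSum q m) t ⟩
      abs (expSum q n - expSum q m) + abs t
        ≤⟨ go m≤′n ⊞ ≤-reflexive (∣expTerm∣ q (suc n)) ⟩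
      expSum (abs q) n - expSum (abs q) m + expTerm (abs q) (suc n)
        ≡⟨ solve 3 (λ a t b → (a :- b) :+ t := a :+ t :- b) refl (expSum (abs q) n) (expTerm (abs q) (suc n)) (expSum (abs q) m) ⟩
      expSum (abs q) n + expTerm (abs q) (suc n) - expSum (abs q) m ∎
      where
        open ≤-Reasoning
        t = expTerm q (suc n)

expTerm-lipschitz : ∀ {p q B} → abs p ≤ B → abs q ≤ B → ∀ k →
                    abs (expTerm p (suc k) - expTerm q (suc k)) ≤ abs (p - q) * expTerm B k
expTerm-lipschitz {p} {q} {B} p≤B q≤B zero = ≤-reflexive (trans
  (cong abs (solve 2 (λ p q → con 1ℚ :* (p :* con 1ℚ) :- con 1ℚ :* (q :* con 1ℚ) := p :- q) refl p q))
  (sym (*-identityʳ (abs (p - q)))))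
expTerm-lipschitz {p} {q} {B} p≤B q≤B (suc k) = begin
  abs (tp * (p * u) - tq * (q * u))
    ≡⟨ cong abs (solve 5 (λ tp tq p q u → tp :* (p :* u) :- tq :* (q :* u) := (tp :- tq) :* (p :* u) :+ tq :* ((p :- q) :* u)) refl tp tq p q u) ⟩
  abs ((tp - tq) * (p * u) + tq * ((p - q) * u))
    ≤⟨ ∣p+q∣≤∣p∣+∣q∣ ((tp - tq) * (p * u)) (tq * ((p - q) * u)) ⟩
  abs ((tp - tq) * (p * u)) + abs (tq * ((p - q) * u))
    ≡⟨ cong₂ _+_ (abs* (tp - tq) p) (abs* tq (p - q)) ⟩
  abs (tp - tq) * (abs p * u) + abs tq * (D * u)
    ≤⟨ *-mono (0≤∣p∣ (tp - tq)) (0≤* 0≤B 0≤u) (expTerm-lipschitz p≤B q≤B k) (*-mono (0≤∣p∣ p) 0≤u p≤B ≤-refl)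
       ⊞ *-monoʳ-≤-nonNeg (D * u) {{nonNegative (0≤* (0≤∣p∣ (p - q)) 0≤u)}} (≤-trans (≤-reflexive (∣expTerm∣ q (suc k))) (expTerm-mono (0≤∣p∣ q) q≤B (suc k))) ⟩
  D * t * (B * u) + t * (B * v) * (D * u)
    ≡⟨ split ⟩
  D * (t * (B * v)) ∎
  where
    open ≤-Reasoning
    tp = expTerm p (suc k)
    tq = expTerm q (suc k)
    u = 1/1+ (suc k)
    v = 1/1+ k
    D = abs (p - q)
    t = expTerm B k
    0≤u = 0≤1/1+ (suc k)
    0≤B = ≤-trans (0≤∣p∣ p) p≤B
    abs* : ∀ x y → abs (x * (y * u)) ≡ abs x * (abs y * u)
    abs* x y = trans (∣p*q∣≡∣p∣*∣q∣ x (y * u)) (cong (abs x *_) (trans (∣p*q∣≡∣p∣*∣q∣ y u) (cong (abs y *_) (0≤p⇒∣p∣≡p 0≤u))))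
    a = ι (suc k)
    av : a * v ≡ 1ℚ
    av = ι-1/1+ k
    au : (a + 1ℚ) * u ≡ 1ℚ
    au = trans (cong (_* u) (sym (ι-suc (suc k)))) (ι-1/1+ (suc k))
    split : D * t * (B * u) + t * (B * v) * (D * u) ≡ D * (t * (B * v))
    split = trans (cong (_+ t * (B * v) * (D * u)) (trans (sym (*-identityʳ (D * t * (B * u)))) (cong (D * t * (B * u) *_) (sym av))))
           (trans (solve 6 (λ D t B u v a → D :* t :* (B :* u) :* (a :* v) :+ t :* (B :* v) :* (D :* u) := ((a :+ con 1ℚ) :* u) :* (D :* (t :* (B :* v)))) refl D t B u v a)
           (trans (cong (_* (D * (t * (B * v)))) au) (*-identityˡ _)))

expSum-lipschitz : ∀ {p q B} → abs p ≤ B → abs q ≤ B → ∀ n → abs (expSum p n - expSum q n) ≤ abs (p - q) * expSum B n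
expSum-lipschitz {p} {q} {B} p≤B q≤B n = ≤-trans (go n) (0≤∣p∣ (p - q) ⊡ pred≤ n)
  where
    0≤B = ≤-trans (0≤∣p∣ p) p≤B
    E⁻ : ℕ → ℚ
    E⁻ zero    = 0ℚ
    E⁻ (suc n) = expSum B n
    pred≤ : ∀ n → E⁻ n ≤ expSum B n
    pred≤ zero    = 0≤1
    pred≤ (suc n) = expSum-monoⁿ 0≤B (ℕₚ.n≤1+n n)
    E⁻-suc : ∀ n → E⁻ n + expTerm B n ≡ E⁻ (suc n)
    E⁻-suc zero    = refl
    E⁻-suc (suc n) = refl
    go : ∀ n → abs (expSum p n - expSum q n) ≤ abs (p - q) * E⁻ n
    go zero    = ≤-reflexive (sym (*-zeroʳ (abs (p - q))))
    go (suc n) = begin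
      abs (expSum p n + expTerm p (suc n) - (expSum q n + expTerm q (suc n)))
        ≡⟨ cong abs (solve 4 (λ a b c d → a :+ b :- (c :+ d) := (a :- c) :+ (b :- d)) refl (expSum p n) (expTerm p (suc n)) (expSum q n) (expTerm q (suc n))) ⟩
      abs ((expSum p n - expSum q n) + (expTerm p (suc n) - expTerm q (suc n)))
        ≤⟨ ∣p+q∣≤∣p∣+∣q∣ (expSum p n - expSum q n) (expTerm p (suc n) - expTerm q (suc n)) ⟩
      abs (expSum p n - expSum q n) + abs (expTerm p (suc n) - expTerm q (suc n))
        ≤⟨ go n ⊞ expTerm-lipschitz p≤B q≤B n ⟩
      abs (p - q) * E⁻ n + abs (p - q) * expTerm B n
        ≡⟨ *-distribˡ-+ (abs (p - q)) (E⁻ n) (expTerm B n) ⟨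
      abs (p - q) * (E⁻ n + expTerm B n)
        ≡⟨ cong (abs (p - q) *_) (E⁻-suc n) ⟩
      abs (p - q) * expSum B n ∎
      where open ≤-Reasoning

Eventually : (ℕ → Set) → Set
Eventually P = ∃ λ N → ∀ n → N ℕ.≤ n → P n

eventually₂ : ∀ {P Q R : ℕ → Set} → (∀ n → P n → Q n → R n) → Eventually P → Eventually Q → Eventually R
eventually₂ f (M , p) (N , q) =
  M ℕ.⊔ N , λ n h → f n (p n (ℕₚ.≤-trans (ℕₚ.m≤m⊔n M N) h)) (q n (ℕₚ.≤-trans (ℕₚ.m≤n⊔m M N) h))

Cauchy : (ℕ → ℚ) → Set
Cauchy f = ∀ δ → 0ℚ < δ → ∃ λ N → ∀ m n → N ℕ.≤ m → N ℕ.≤ n → abs (f m - f n) ≤ δ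

record ℝ : Set where
  field
    seq    : ℕ → ℚ
    cauchy : Cauchy seq
open ℝ public

infix 4 _≤ℝ_ _<ℝ_ _≃ℝ_

_≤ℝ_ : ℝ → ℝ → Set
x ≤ℝ y = ∀ δ → 0ℚ < δ → Eventually λ n → seq x n ≤ seq y n + δ

_<ℝ_ : ℝ → ℝ → Set
x <ℝ y = ∃ λ δ → 0ℚ < δ × Eventually λ n → seq x n + δ ≤ seq y n

_≃ℝ_ : ℝ → ℝ → Set
x ≃ℝ y = x ≤ℝ y × y ≤ℝ x

one-sided : ∀ f → (∀ δ → 0ℚ < δ → ∃ λ N → ∀ m n → N ℕ.≤ m → N ℕ.≤ n → f m ≤ f n + δ) → Cauchy f
one-sided f h δ 0<δ = proj₁ (h δ 0<δ) , λ m n N≤m N≤n →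
  ∣p∣≤ (by (proj₂ (h δ 0<δ) m n N≤m N≤n) (solve 3 (λ x y d → d :+ x := (x :- y) :+ (y :+ d)) refl (f m) (f n) δ))
       (by (proj₂ (h δ 0<δ) n m N≤n N≤m) (solve 3 (λ x y d → d :+ y := (:- (x :- y)) :+ (x :+ d)) refl (f m) (f n) δ))

cauchy≤ : ∀ x δ → 0ℚ < δ → ∃ λ N → ∀ m n → N ℕ.≤ m → N ℕ.≤ n → seq x m ≤ seq x n + δ
cauchy≤ x δ 0<δ = proj₁ (cauchy x δ 0<δ) , λ m n N≤m N≤n →
  by (≤-trans (p≤∣p∣ (seq x m - seq x n)) (proj₂ (cauchy x δ 0<δ) m n N≤m N≤n))
     (solve 3 (λ x y d → (y :+ d) :+ (x :- y) := x :+ d) refl (seq x m) (seq x n) δ)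

bound : ∀ x → ∃ λ b → Eventually λ n → abs (seq x n) ≤ ι b
bound x = ℤ.∣ ↥ B ∣ , N , λ n N≤n → begin
  abs (seq x n)                          ≡⟨ cong abs (solve 2 (λ a b → a := (a :- b) :+ b) refl (seq x n) (seq x N)) ⟩
  abs ((seq x n - seq x N) + seq x N)    ≤⟨ ∣p+q∣≤∣p∣+∣q∣ (seq x n - seq x N) (seq x N) ⟩
  abs (seq x n - seq x N) + abs (seq x N) ≤⟨ +-monoˡ-≤ (abs (seq x N)) (proj₂ c n N N≤n ℕₚ.≤-refl) ⟩
  B                                      ≤⟨ ≤ι B ⟩
  ι ℤ.∣ ↥ B ∣                            ∎
  where
    open ≤-Reasoning
    c = cauchy x 1ℚ (positive⁻¹ 1ℚ)
    N = proj₁ c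
    B = 1ℚ + abs (seq x N)

fromℚ : ℚ → ℝ
fromℚ q .seq n = q
fromℚ q .cauchy δ 0<δ = 0 , λ _ _ _ _ → subst (_≤ δ) (sym (cong abs (+-inverseʳ q))) (<⇒≤ 0<δ)

fromℕ : ℕ → ℝ
fromℕ n = fromℚ (ι n)

infix  8 -ℝ_
infixl 7 _*ℝ_
infixl 6 _+ℝ_ _-ℝ_

_+ℝ_ : ℝ → ℝ → ℝ
(x +ℝ y) .seq n = seq x n + seq y n
(x +ℝ y) .cauchy = one-sided ((x +ℝ y) .seq) λ δ 0<δ →
  let (M , h) = cauchy≤ x (½ * δ) (0<½* 0<δ)
      (N , k) = cauchy≤ y (½ * δ) (0<½* 0<δ)
  in M ℕ.⊔ N , λ m n p q →
     by (h m n (ℕₚ.≤-trans (ℕₚ.m≤m⊔n M N) p) (ℕₚ.≤-trans (ℕₚ.m≤m⊔n M N) q)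
         ⊞ k m n (ℕₚ.≤-trans (ℕₚ.m≤n⊔m M N) p) (ℕₚ.≤-trans (ℕₚ.m≤n⊔m M N) q))
        (solve 5 (λ a b c d e → (c :+ d :+ e) :+ (a :+ b) := (a :+ b) :+ ((c :+ con ½ :* e) :+ (d :+ con ½ :* e))) refl
          (seq x m) (seq y m) (seq x n) (seq y n) δ)

-ℝ_ : ℝ → ℝ
(-ℝ x) .seq n = - seq x n
(-ℝ x) .cauchy = one-sided ((-ℝ x) .seq) λ δ 0<δ →
  let (N , h) = cauchy≤ x δ 0<δ
  in N , λ m n p q → by (h n m q p)
       (solve 3 (λ a b e → (:- b :+ e) :+ b := :- a :+ (a :+ e)) refl (seq x m) (seq x n) δ)

_-ℝ_ : ℝ → ℝ → ℝ
x -ℝ y = x +ℝ -ℝ y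

_*ℝ_ : ℝ → ℝ → ℝ
(x *ℝ y) .seq n = seq x n * seq y n
(x *ℝ y) .cauchy δ 0<δ = N , λ m n p q →
  let a = seq x m ; a′ = seq x n ; b = seq y m ; b′ = seq y n
      open ≤-Reasoning
  in begin
  abs (a * b - a′ * b′)
    ≡⟨ cong abs (solve 4 (λ a a′ b b′ → a :* b :- a′ :* b′ := a :* (b :- b′) :+ (a :- a′) :* b′) refl a a′ b b′) ⟩
  abs (a * (b - b′) + (a - a′) * b′)
    ≤⟨ ∣p+q∣≤∣p∣+∣q∣ (a * (b - b′)) ((a - a′) * b′) ⟩
  abs (a * (b - b′)) + abs ((a - a′) * b′)
    ≡⟨ cong₂ _+_ (∣p*q∣≡∣p∣*∣q∣ a (b - b′)) (∣p*q∣≡∣p∣*∣q∣ (a - a′) b′) ⟩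
  abs a * abs (b - b′) + abs (a - a′) * abs b′
    ≤⟨ *-mono (0≤∣p∣ a) (<⇒≤ 0<η) (≤-trans (proj₂ (proj₂ bx) m (N₁≤ p)) Bx≤B) (proj₂ cy m n (N₄≤ p) (N₄≤ q))
       ⊞ *-mono (0≤∣p∣ (a - a′)) (<⇒≤ 0<B) (proj₂ cx m n (N₃≤ p) (N₃≤ q)) (≤-trans (proj₂ (proj₂ by′) n (N₂≤ q)) By≤B) ⟩
  B * η + η * B
    ≡⟨ solve 3 (λ B r d → B :* (con ½ :* d :* r) :+ (con ½ :* d :* r) :* B := (B :* r) :* d) refl B (recip B) δ ⟩
  B * recip B * δ
    ≡⟨ trans (cong (_* δ) (recip-inverse 0<B)) (*-identityˡ δ) ⟩
  δ ∎
  where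
    bx = bound x
    by′ = bound y
    B = ι (suc (proj₁ bx ℕ.+ proj₁ by′))
    0<B : 0ℚ < B
    0<B = <-≤-trans (positive⁻¹ 1ℚ) (ι-mono {1} {suc (proj₁ bx ℕ.+ proj₁ by′)} (ℕ.s≤s ℕ.z≤n))
    Bx≤B : ι (proj₁ bx) ≤ B
    Bx≤B = ι-mono (ℕₚ.m≤n⇒m≤1+n (ℕₚ.m≤m+n (proj₁ bx) (proj₁ by′)))
    By≤B : ι (proj₁ by′) ≤ B
    By≤B = ι-mono (ℕₚ.m≤n⇒m≤1+n (ℕₚ.m≤n+m (proj₁ by′) (proj₁ bx)))
    η = ½ * δ * recip B
    0<η : 0ℚ < η
    0<η = 0<* (0<½* 0<δ) (0<recip 0<B)
    cx = cauchy x η 0<η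
    cy = cauchy y η 0<η
    N₁ = proj₁ (proj₂ bx)
    N₂ = proj₁ (proj₂ by′)
    N₃ = proj₁ cx
    N₄ = proj₁ cy
    N = (N₁ ℕ.⊔ N₂) ℕ.⊔ (N₃ ℕ.⊔ N₄)
    N₁≤ : ∀ {n} → N ℕ.≤ n → N₁ ℕ.≤ n
    N₁≤ p = ℕₚ.≤-trans (ℕₚ.m≤m⊔n N₁ N₂) (ℕₚ.≤-trans (ℕₚ.m≤m⊔n (N₁ ℕ.⊔ N₂) (N₃ ℕ.⊔ N₄)) p)
    N₂≤ : ∀ {n} → N ℕ.≤ n → N₂ ℕ.≤ n
    N₂≤ p = ℕₚ.≤-trans (ℕₚ.m≤n⊔m N₁ N₂) (ℕₚ.≤-trans (ℕₚ.m≤m⊔n (N₁ ℕ.⊔ N₂) (N₃ ℕ.⊔ N₄)) p)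
    N₃≤ : ∀ {n} → N ℕ.≤ n → N₃ ℕ.≤ n
    N₃≤ p = ℕₚ.≤-trans (ℕₚ.m≤m⊔n N₃ N₄) (ℕₚ.≤-trans (ℕₚ.m≤n⊔m (N₁ ℕ.⊔ N₂) (N₃ ℕ.⊔ N₄)) p)
    N₄≤ : ∀ {n} → N ℕ.≤ n → N₄ ℕ.≤ n
    N₄≤ p = ℕₚ.≤-trans (ℕₚ.m≤n⊔m N₃ N₄) (ℕₚ.≤-trans (ℕₚ.m≤n⊔m (N₁ ℕ.⊔ N₂) (N₃ ℕ.⊔ N₄)) p)

0ℝ 1ℝ ½ℝ : ℝ
0ℝ = fromℚ 0ℚ
1ℝ = fromℚ 1ℚ
½ℝ = fromℚ ½

positive-bound : ∀ {x} → 0ℝ <ℝ x → ∃ λ c → 0ℚ < c × Eventually λ n → c ≤ seq x n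
positive-bound {x} (c , 0<c , N , h) = c , 0<c , N , λ n N≤n → subst (_≤ seq x n) (+-identityˡ c) (h n N≤n)

bound-positive : ∀ {x} c → 0ℚ < c → (Eventually λ n → c ≤ seq x n) → 0ℝ <ℝ x
bound-positive {x} c 0<c (N , h) = c , 0<c , N , λ n N≤n → subst (_≤ seq x n) (sym (+-identityˡ c)) (h n N≤n)

recip-antitone : ∀ {a b c δ} → 0ℚ < c → c ≤ a → c ≤ b → 0ℚ < δ → b ≤ a + c * c * δ → recip a ≤ recip b + δ
recip-antitone {a} {b} {c} {δ} 0<c c≤a c≤b 0<δ b≤a+c²δ =
  by h (trans (solve 5 (λ a b r s d → (s :+ d) :+ r :* s :* b := (s :+ d) :+ r :* (b :* s)) refl a b r s δ)
       (trans (cong (λ z → s + δ + r * z) bs)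
       (trans (solve 3 (λ r s d → s :+ d :+ r :* con 1ℚ := r :+ (con 1ℚ :* s :+ (con 1ℚ :* con 1ℚ) :* d)) refl r s δ)
       (trans (cong₂ (λ y z → r + (y * s + (y * z) * δ)) (sym ar) (sym bs))
              (solve 5 (λ a b r s d → r :+ ((a :* r) :* s :+ ((a :* r) :* (b :* s)) :* d) := r :+ r :* s :* (a :+ a :* b :* d)) refl a b r s δ)))))
  where
    r = recip a
    s = recip b
    0<a = <-≤-trans 0<c c≤a
    0<b = <-≤-trans 0<c c≤b
    ar = recip-inverse 0<a
    bs = recip-inverse 0<b
    h : r * s * b ≤ r * s * (a + a * b * δ)
    h = <⇒≤ (0<* (0<recip 0<a) (0<recip 0<b)) ⊡
        ≤-trans b≤a+c²δ (+-monoʳ-≤ a (*-monoʳ-≤-nonNeg δ {{nonNegative (<⇒≤ 0<δ)}}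
          (*-mono (<⇒≤ 0<c) (<⇒≤ 0<b) c≤a c≤b)))

infix 9 _⁻¹[_]

_⁻¹[_] : (x : ℝ) → 0ℝ <ℝ x → ℝ
(x ⁻¹[ 0<x ]) .seq n = recip (seq x n)
(x ⁻¹[ 0<x ]) .cauchy = one-sided ((x ⁻¹[ 0<x ]) .seq) λ δ 0<δ →
  let (c , 0<c , M , h) = positive-bound {x} 0<x
      (N , k) = cauchy≤ x (c * c * δ) (0<* (0<* 0<c 0<c) 0<δ)
  in M ℕ.⊔ N , λ m n p q →
     recip-antitone 0<c (h m (ℕₚ.≤-trans (ℕₚ.m≤m⊔n M N) p)) (h n (ℕₚ.≤-trans (ℕₚ.m≤m⊔n M N) q)) 0<δ
       (k n m (ℕₚ.≤-trans (ℕₚ.m≤n⊔m M N) q) (ℕₚ.≤-trans (ℕₚ.m≤n⊔m M N) p))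

⁻¹-positive : ∀ {x} (0<x : 0ℝ <ℝ x) → 0ℝ <ℝ x ⁻¹[ 0<x ]
⁻¹-positive {x} 0<x =
  bound-positive {x ⁻¹[ 0<x ]} (recip B) (0<recip 0<B)
    (eventually₂ f (proj₂ (bound x)) (proj₂ (proj₂ (positive-bound {x} 0<x))))
  where
    b = proj₁ (bound x)
    c = proj₁ (positive-bound {x} 0<x)
    0<c = proj₁ (proj₂ (positive-bound {x} 0<x))
    B = ι (suc b)
    0<B : 0ℚ < B
    0<B = <-≤-trans (positive⁻¹ 1ℚ) (ι-mono {1} {suc b} (ℕ.s≤s ℕ.z≤n))
    f : ∀ n → abs (seq x n) ≤ ι b → c ≤ seq x n → recip B ≤ recip (seq x n)
    f n xn≤b c≤xn =
      by (<⇒≤ (0<* (0<recip 0<B) (0<recip 0<a)) ⊡ a≤B)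
         (trans (solve 4 (λ a B r s → s :+ (r :* s) :* a := s :+ r :* (a :* s)) refl a B r s)
         (trans (cong (λ z → s + r * z) (recip-inverse 0<a))
         (trans (solve 2 (λ r s → s :+ r :* con 1ℚ := r :+ con 1ℚ :* s) refl r s)
         (trans (cong (λ z → r + z * s) (sym (recip-inverse 0<B)))
                (solve 3 (λ B r s → r :+ (B :* r) :* s := r :+ (r :* s) :* B) refl B r s)))))
      where
        a = seq x n
        r = recip B
        s = recip a
        0<a = <-≤-trans 0<c c≤xn
        a≤B : a ≤ B
        a≤B = ≤-trans (p≤∣p∣ a) (≤-trans xn≤b (ι-mono (ℕₚ.n≤1+n b)))

*ℝ-positive : ∀ {x y} → 0ℝ <ℝ x → 0ℝ <ℝ y → 0ℝ <ℝ x *ℝ y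
*ℝ-positive {x} {y} 0<x 0<y =
  let (c , 0<c , h) = positive-bound {x} 0<x
      (d , 0<d , k) = positive-bound {y} 0<y
  in bound-positive {x *ℝ y} (c * d) (0<* 0<c 0<d)
       (eventually₂ (λ n c≤ d≤ → *-mono (<⇒≤ 0<c) (≤-trans (<⇒≤ 0<d) d≤) c≤ d≤) h k)

1-ε-positive : ∀ {ε} → ε <ℝ ½ℝ → 0ℝ <ℝ 1ℝ -ℝ ε
1-ε-positive {ε} (δ , 0<δ , N , h) = bound-positive {1ℝ -ℝ ε} δ 0<δ
  (N , λ n N≤n → by (h n N≤n ⊞ <⇒≤ 0<½)
    (solve 2 (λ d e → (con 1ℚ :- e) :+ ((e :+ d) :+ con 0ℚ) := d :+ (con ½ :+ con ½)) refl δ (seq ε n)))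

exp : ℝ → ℝ
exp x .seq n = expSum (seq x n) n
exp x .cauchy δ 0<δ = N , λ m n N≤m N≤n → begin
  abs (expSum (seq x m) m - expSum (seq x n) n)
    ≡⟨ cong abs (solve 3 (λ a b c → a :- c := (a :- b) :+ (b :- c)) refl
         (expSum (seq x m) m) (expSum (seq x n) m) (expSum (seq x n) n)) ⟩
  abs ((expSum (seq x m) m - expSum (seq x n) m) + (expSum (seq x n) m - expSum (seq x n) n))
    ≤⟨ ∣p+q∣≤∣p∣+∣q∣ (expSum (seq x m) m - expSum (seq x n) m) (expSum (seq x n) m - expSum (seq x n) n) ⟩
  abs (expSum (seq x m) m - expSum (seq x n) m) + abs (expSum (seq x n) m - expSum (seq x n) n)
    ≤⟨ lip m n N≤m N≤n ⊞ tails m n N≤m N≤n ⟩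
  ½ * δ + ½ * δ
    ≡⟨ ½+½ δ ⟩
  δ ∎
  where
    open ≤-Reasoning
    b = proj₁ (bound x)
    N₁ = proj₁ (proj₂ (bound x))
    xb = proj₂ (proj₂ (bound x))
    E = expSum-bound b
    C = proj₁ E
    0<C : 0ℚ < C
    0<C = <-≤-trans (positive⁻¹ 1ℚ) (proj₂ E 0)
    η = ½ * δ * recip C
    0<η : 0ℚ < η
    0<η = 0<* (0<½* 0<δ) (0<recip 0<C)
    c = cauchy x η 0<η
    N₂ = proj₁ c
    T = expSum-tail b (0<½* 0<δ)
    N₃ = proj₁ T
    N = N₁ ℕ.⊔ (N₂ ℕ.⊔ N₃)
    N₁≤ : ∀ {n} → N ℕ.≤ n → N₁ ℕ.≤ n
    N₁≤ = ℕₚ.≤-trans (ℕₚ.m≤m⊔n N₁ (N₂ ℕ.⊔ N₃))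
    N₂≤ : ∀ {n} → N ℕ.≤ n → N₂ ℕ.≤ n
    N₂≤ p = ℕₚ.≤-trans (ℕₚ.m≤m⊔n N₂ N₃) (ℕₚ.≤-trans (ℕₚ.m≤n⊔m N₁ (N₂ ℕ.⊔ N₃)) p)
    N₃≤ : ∀ {n} → N ℕ.≤ n → N₃ ℕ.≤ n
    N₃≤ p = ℕₚ.≤-trans (ℕₚ.m≤n⊔m N₂ N₃) (ℕₚ.≤-trans (ℕₚ.m≤n⊔m N₁ (N₂ ℕ.⊔ N₃)) p)
    lip : ∀ m n → N ℕ.≤ m → N ℕ.≤ n → abs (expSum (seq x m) m - expSum (seq x n) m) ≤ ½ * δ
    lip m n N≤m N≤n = begin
      abs (expSum (seq x m) m - expSum (seq x n) m)
        ≤⟨ expSum-lipschitz (xb m (N₁≤ N≤m)) (xb n (N₁≤ N≤n)) m ⟩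
      abs (seq x m - seq x n) * expSum (ι b) m
        ≤⟨ *-mono (0≤∣p∣ (seq x m - seq x n)) (<⇒≤ 0<C) (proj₂ c m n (N₂≤ N≤m) (N₂≤ N≤n)) (proj₂ E m) ⟩
      η * C
        ≡⟨ solve 3 (λ C r d → d :* r :* C := C :* r :* d) refl C (recip C) (½ * δ) ⟩
      C * recip C * (½ * δ)
        ≡⟨ trans (cong (_* (½ * δ)) (recip-inverse 0<C)) (*-identityˡ (½ * δ)) ⟩
      ½ * δ ∎
    tail : ∀ q m n → abs q ≤ ι b → N ℕ.≤ m → m ℕ.≤ n → abs (expSum q n - expSum q m) ≤ ½ * δ
    tail q m n q≤b N≤m m≤n = ≤-trans (∣expSum-diff∣ q m≤n)
      (by (proj₂ T m (N₃≤ N≤m) n (0≤∣p∣ q) q≤b)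
          (solve 3 (λ a c d → d :+ a := (a :- c) :+ (c :+ d)) refl (expSum (abs q) n) (expSum (abs q) m) (½ * δ)))
    tails : ∀ m n → N ℕ.≤ m → N ℕ.≤ n → abs (expSum (seq x n) m - expSum (seq x n) n) ≤ ½ * δ
    tails m n N≤m N≤n = case (ℕₚ.≤-total m n)
      where
        flip-abs : ∀ a c → abs (a - c) ≡ abs (c - a)
        flip-abs a c = trans (sym (∣-p∣≡∣p∣ (a - c))) (cong abs (solve 2 (λ a c → :- (a :- c) := c :- a) refl a c))
        case : m ℕ.≤ n ⊎ n ℕ.≤ m → abs (expSum (seq x n) m - expSum (seq x n) n) ≤ ½ * δ
        case (inj₁ m≤n) = subst (_≤ ½ * δ) (flip-abs (expSum (seq x n) n) (expSum (seq x n) m))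
                            (tail (seq x n) m n (xb n (N₁≤ N≤n)) N≤m m≤n)
        case (inj₂ n≤m) = tail (seq x n) n m (xb n (N₁≤ N≤n)) N≤n n≤m

-- least p m is the least i ≤ m with p i, or m if there is none
least : (ℕ → Bool) → ℕ → ℕ
least p zero    = zero
least p (suc m) = if p 0 then 0 else suc (least (p ∘ suc) m)

least-true : ∀ (p : ℕ → Bool) m → p m ≡ true → p (least p m) ≡ true
least-true p zero    h = h
least-true p (suc m) h with p 0 in eq
... | true  = eq
... | false = least-true (p ∘ suc) m h

least-false : ∀ (p : ℕ → Bool) m j → j ℕ.< least p m → p j ≡ false
least-false p (suc m) j j< with p 0 in eq
least-false p (suc m) zero    j<         | false = eq
least-false p (suc m) (suc j) (ℕ.s≤s j<) | false = least-false (p ∘ suc) m j j<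

grid : ℕ → ℕ → ℚ
grid n i = ι i * 1/1+ n

exceeds : ℚ → ℕ → ℕ → Bool
exceeds q n i = does (q <? expSum (grid n i) (suc n))

-- The least point of the grid {i/(n+1)} whose exponential, computed to order
-- n + 1, exceeds q.  The cut-off does not matter since e^k > k ≥ q for k = ∣↥ q∣.
log⁺ℚ : ℚ → ℕ → ℚ
log⁺ℚ q n = grid n (least (exceeds q n) (suc n ℕ.* ℤ.∣ ↥ q ∣))

does-true : ∀ {A : Set} (d : Dec A) → does d ≡ true → A
does-true (yes a) _ = a

does-false : ∀ {A : Set} (d : Dec A) → does d ≡ false → ¬ A
does-false (no ¬a) _ = ¬a

0≤grid : ∀ n i → 0ℚ ≤ grid n i
0≤grid n i = 0≤* (0≤ι i) (0≤1/1+ n)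

grid-suc : ∀ n i → grid n (suc i) ≡ grid n i + 1/1+ n
grid-suc n i = trans (cong (_* 1/1+ n) (ι-suc i))
  (solve 2 (λ a u → (a :+ con 1ℚ) :* u := a :* u :+ u) refl (ι i) (1/1+ n))

0≤log⁺ℚ : ∀ q n → 0ℚ ≤ log⁺ℚ q n
0≤log⁺ℚ q n = 0≤grid n (least (exceeds q n) (suc n ℕ.* ℤ.∣ ↥ q ∣))

log⁺ℚ-exceeds : ∀ q n → q < expSum (log⁺ℚ q n) (suc n)
log⁺ℚ-exceeds q n = does-true (q <? expSum (grid n (least (exceeds q n) M)) (suc n))
  (least-true (exceeds q n) M (dec-true (q <? expSum (grid n M) (suc n)) top))
  where
    k = ℤ.∣ ↥ q ∣
    M = suc n ℕ.* k
    eq : grid n M ≡ ι k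
    eq = trans (cong (_* 1/1+ n) (ι-* (suc n) k))
        (trans (solve 3 (λ a b u → a :* b :* u := a :* u :* b) refl (ι (suc n)) (ι k) (1/1+ n))
        (trans (cong (_* ι k) (ι-1/1+ n)) (*-identityˡ (ι k))))
    top : q < expSum (grid n M) (suc n)
    top = <-≤-trans (≤-<-trans (≤ι q) (subst (_< 1ℚ + ι k) (+-identityˡ (ι k)) (+-monoˡ-< (ι k) (positive⁻¹ 1ℚ))))
          (subst (λ z → 1ℚ + z ≤ expSum (grid n M) (suc n)) eq (1+q≤expSum (0≤grid n M) n))

log⁺ℚ-least : ∀ q n → log⁺ℚ q n ≡ 0ℚ ⊎
              (∃ λ p → 0ℚ ≤ p × log⁺ℚ q n ≡ p + 1/1+ n × expSum p (suc n) ≤ q)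
log⁺ℚ-least q n = go (least (exceeds q n) M) refl
  where
    M = suc n ℕ.* ℤ.∣ ↥ q ∣
    go : ∀ i → least (exceeds q n) M ≡ i → grid n (least (exceeds q n) M) ≡ 0ℚ ⊎
         (∃ λ p → 0ℚ ≤ p × grid n (least (exceeds q n) M) ≡ p + 1/1+ n × expSum p (suc n) ≤ q)
    go zero    e = inj₁ (trans (cong (grid n) e) (*-zeroˡ (1/1+ n)))
    go (suc j) e = inj₂ (grid n j , 0≤grid n j , trans (cong (grid n) e) (grid-suc n j) ,
      ≮⇒≥ (does-false (q <? expSum (grid n j) (suc n))
        (least-false (exceeds q n) M j (subst (j ℕ.<_) (sym e) ℕₚ.≤-refl))))

-- log⁺ x = max (log x) 0, by log⁺-nonpositive and exp-log⁺ below
log⁺ : ℝ → ℝ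
log⁺ x .seq n = log⁺ℚ (seq x n) n
log⁺ x .cauchy = one-sided (log⁺ x .seq) λ δ 0<δ →
  let η = ½ * (½ * δ)
      0<η = 0<½* (0<½* 0<δ)
      (b , N₁ , xb) = bound x
      (N₂ , c) = cauchy≤ x η 0<η
      (N₃ , tail) = expSum-tail b 0<η
      (N₄ , arch) = archimedean 1ℚ (0<½* 0<δ)
      N = (N₁ ℕ.⊔ N₂) ℕ.⊔ (N₃ ℕ.⊔ N₄)
      N₁≤ : ∀ {n} → N ℕ.≤ n → N₁ ℕ.≤ n
      N₁≤ p = ℕₚ.≤-trans (ℕₚ.m≤m⊔n N₁ N₂) (ℕₚ.≤-trans (ℕₚ.m≤m⊔n (N₁ ℕ.⊔ N₂) (N₃ ℕ.⊔ N₄)) p)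
      N₂≤ : ∀ {n} → N ℕ.≤ n → N₂ ℕ.≤ n
      N₂≤ p = ℕₚ.≤-trans (ℕₚ.m≤n⊔m N₁ N₂) (ℕₚ.≤-trans (ℕₚ.m≤m⊔n (N₁ ℕ.⊔ N₂) (N₃ ℕ.⊔ N₄)) p)
      N₃≤ : ∀ {n} → N ℕ.≤ n → N₃ ℕ.≤ n
      N₃≤ p = ℕₚ.≤-trans (ℕₚ.m≤m⊔n N₃ N₄) (ℕₚ.≤-trans (ℕₚ.m≤n⊔m (N₁ ℕ.⊔ N₂) (N₃ ℕ.⊔ N₄)) p)
      N₄≤ : ∀ {n} → N ℕ.≤ n → N₄ ℕ.≤ n
      N₄≤ p = ℕₚ.≤-trans (ℕₚ.m≤n⊔m N₃ N₄) (ℕₚ.≤-trans (ℕₚ.m≤n⊔m (N₁ ℕ.⊔ N₂) (N₃ ℕ.⊔ N₄)) p)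
  in N , λ m n p q →
     log⁺ℚ-close 0<δ b m n (≤-trans (p≤∣p∣ (seq x m)) (xb m (N₁≤ p)))
       (c m n (N₂≤ p) (N₂≤ q)) (λ {r} 0≤r r≤b → tail (suc m) (ℕₚ.m≤n⇒m≤1+n (N₃≤ p)) (suc n) 0≤r r≤b)
       (subst (_≤ ½ * δ) (*-identityˡ (1/1+ m)) (arch m (N₄≤ p)))
  where
    log⁺ℚ-close : ∀ {δ} → 0ℚ < δ → ∀ b m n → seq x m ≤ ι b → seq x m ≤ seq x n + ½ * (½ * δ) →
      (∀ {r} → 0ℚ ≤ r → r ≤ ι b → expSum r (suc n) ≤ expSum r (suc m) + ½ * (½ * δ)) →
      1/1+ m ≤ ½ * δ → log⁺ℚ (seq x m) m ≤ log⁺ℚ (seq x n) n + δ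
    log⁺ℚ-close {δ} 0<δ b m n xm≤b close tail small = go (log⁺ℚ-least (seq x m) m)
      where
        ℓ = log⁺ℚ (seq x n) n
        η = ½ * (½ * δ)
        0≤½δ = <⇒≤ (0<½* 0<δ)
        go : log⁺ℚ (seq x m) m ≡ 0ℚ ⊎
             (∃ λ r → 0ℚ ≤ r × log⁺ℚ (seq x m) m ≡ r + 1/1+ m × expSum r (suc m) ≤ seq x m) →
             log⁺ℚ (seq x m) m ≤ ℓ + δ
        go (inj₁ e) = subst (_≤ ℓ + δ) (sym e) (0≤log⁺ℚ (seq x n) n ⊞ <⇒≤ 0<δ)
        go (inj₂ (r , 0≤r , e , E≤)) = subst (_≤ ℓ + δ) (sym e) (case (≤-total r ℓ))
          where
            case : r ≤ ℓ ⊎ ℓ ≤ r → r + 1/1+ m ≤ ℓ + δ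
            case (inj₁ r≤ℓ) = by (r≤ℓ ⊞ (small ⊞ 0≤½δ))
              (solve 4 (λ r l u d → (l :+ d) :+ (r :+ (u :+ con 0ℚ)) := (r :+ u) :+ (l :+ (con ½ :* d :+ con ½ :* d))) refl r ℓ (1/1+ m) δ)
            case (inj₂ ℓ≤r) =
              by (<⇒≤ (log⁺ℚ-exceeds (seq x n) n) ⊞ (tail (0≤log⁺ℚ (seq x n) n) (≤-trans ℓ≤r r≤b) ⊞
                  (expSum-growth (0≤log⁺ℚ (seq x n) n) ℓ≤r m ⊞ (E≤ ⊞ (close ⊞ small)))))
                 (solve 9 (λ r l u d xm xn En Em Er →
                     (l :+ d) :+ (xn :+ (En :+ ((Em :+ (r :- l)) :+ (Er :+ (xm :+ u))))) :=
                     (r :+ u) :+ (En :+ ((Em :+ con ½ :* (con ½ :* d)) :+ (Er :+ (xm :+ ((xn :+ con ½ :* (con ½ :* d)) :+ con ½ :* d)))))) refl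
                   r ℓ (1/1+ m) δ (seq x m) (seq x n) (expSum ℓ (suc n)) (expSum ℓ (suc m)) (expSum r (suc m)))
              where
                r≤b : r ≤ ι b
                r≤b = by (1+q≤expSum 0≤r m ⊞ (E≤ ⊞ (xm≤b ⊞ 0≤1)))
                  (solve 4 (λ r b E x → b :+ ((con 1ℚ :+ r) :+ (E :+ (x :+ con 0ℚ))) := r :+ (E :+ (x :+ (b :+ con 1ℚ)))) refl
                    r (ι b) (expSum r (suc m)) (seq x m))

log⁺-nonpositive : ∀ x → x ≤ℝ 1ℝ → log⁺ x ≃ℝ 0ℝ
log⁺-nonpositive x x≤1 = ≤0 , λ δ 0<δ → 0 , λ n _ → 0≤log⁺ℚ (seq x n) n ⊞ <⇒≤ 0<δ
  where
    ≤0 : log⁺ x ≤ℝ 0ℝ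
    ≤0 δ 0<δ = eventually₂ f (x≤1 (½ * δ) (0<½* 0<δ)) (archimedean 1ℚ (0<½* 0<δ))
      where
        f : ∀ n → seq x n ≤ 1ℚ + ½ * δ → 1ℚ * 1/1+ n ≤ ½ * δ → log⁺ℚ (seq x n) n ≤ 0ℚ + δ
        f n x≤ u≤ = go (log⁺ℚ-least (seq x n) n)
          where
            go : log⁺ℚ (seq x n) n ≡ 0ℚ ⊎
                 (∃ λ r → 0ℚ ≤ r × log⁺ℚ (seq x n) n ≡ r + 1/1+ n × expSum r (suc n) ≤ seq x n) →
                 log⁺ℚ (seq x n) n ≤ 0ℚ + δ
            go (inj₁ e) = subst (_≤ 0ℚ + δ) (sym e) (≤-refl {0ℚ} ⊞ <⇒≤ 0<δ)
            go (inj₂ (r , 0≤r , e , E≤)) = subst (_≤ 0ℚ + δ) (sym e)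
              (by (1+q≤expSum 0≤r n ⊞ (E≤ ⊞ (x≤ ⊞ u≤)))
                  (solve 5 (λ r E x u d → (con 0ℚ :+ d) :+ ((con 1ℚ :+ r) :+ (E :+ (x :+ con 1ℚ :* u))) :=
                       (r :+ u) :+ (E :+ (x :+ ((con 1ℚ :+ con ½ :* d) :+ con ½ :* d)))) refl
                     r (expSum r (suc n)) (seq x n) (1/1+ n) δ))

exp-log⁺ : ∀ x → 1ℝ ≤ℝ x → exp (log⁺ x) ≃ℝ x
exp-log⁺ x 1≤x = ≤x , x≤
  where
    ℓ : ℕ → ℚ
    ℓ = seq (log⁺ x)
    b = proj₁ (bound (log⁺ x))
    E = expSum-bound b
    C = proj₁ E
    0<C : 0ℚ < C
    0<C = <-≤-trans (positive⁻¹ 1ℚ) (proj₂ E 0)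
    x≤ : x ≤ℝ exp (log⁺ x)
    x≤ δ 0<δ = eventually₂ f (proj₂ (bound (log⁺ x))) (expSum-tail b 0<δ)
      where
        f : ∀ n → abs (ℓ n) ≤ ι b → (∀ m {q} → 0ℚ ≤ q → q ≤ ι b → expSum q m ≤ expSum q n + δ) →
            seq x n ≤ expSum (ℓ n) n + δ
        f n ℓ≤b tail = ≤-trans (<⇒≤ (log⁺ℚ-exceeds (seq x n) n))
          (tail (suc n) (0≤log⁺ℚ (seq x n) n) (≤-trans (p≤∣p∣ (ℓ n)) ℓ≤b))
    ≤x : exp (log⁺ x) ≤ℝ x
    ≤x δ 0<δ = eventually₂ f (proj₂ (bound (log⁺ x))) (eventually₂ (λ n → _,_) (1≤x δ 0<δ) (archimedean C 0<δ))
      where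
        f : ∀ n → abs (ℓ n) ≤ ι b → (1ℚ ≤ seq x n + δ) × (C * 1/1+ n ≤ δ) → expSum (ℓ n) n ≤ seq x n + δ
        f n ℓ≤b (1≤ , C≤) = go (log⁺ℚ-least (seq x n) n)
          where
            go : ℓ n ≡ 0ℚ ⊎ (∃ λ r → 0ℚ ≤ r × ℓ n ≡ r + 1/1+ n × expSum r (suc n) ≤ seq x n) →
                 expSum (ℓ n) n ≤ seq x n + δ
            go (inj₁ e) = subst (_≤ seq x n + δ) (sym (trans (cong (λ z → expSum z n) e) (expSum-0 n))) 1≤
            go (inj₂ (r , 0≤r , e , E≤)) =
              by (≤-trans (p≤∣p∣ (expSum (ℓ n) n - expSum r n)) lip ⊞ (expSum-monoⁿ 0≤r (ℕₚ.n≤1+n n) ⊞ (E≤ ⊞ C≤′)))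
                 (solve 6 (λ Eℓ Er Er′ x d c → (x :+ d) :+ ((Eℓ :- Er) :+ (Er :+ (Er′ :+ c))) := Eℓ :+ (c :+ (Er′ :+ (x :+ d)))) refl
                   (expSum (ℓ n) n) (expSum r n) (expSum r (suc n)) (seq x n) δ (1/1+ n * C))
              where
                u = 1/1+ n
                C≤′ : u * C ≤ δ
                C≤′ = subst (_≤ δ) (*-comm C u) C≤
                r≤ℓ : r ≤ ℓ n
                r≤ℓ = subst (r ≤_) (sym e) (by (0≤1/1+ n) (solve 2 (λ r u → (r :+ u) :+ con 0ℚ := r :+ u) refl r u))
                diff : ℓ n - r ≡ u
                diff = trans (cong (_- r) e) (solve 2 (λ r u → (r :+ u) :- r := u) refl r u)
                lip : abs (expSum (ℓ n) n - expSum r n) ≤ u * C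
                lip = ≤-trans (expSum-lipschitz ℓ≤b r≤b n)
                  (subst (λ z → z * expSum (ι b) n ≤ u * C) (sym (trans (cong abs diff) (0≤p⇒∣p∣≡p (0≤1/1+ n))))
                    (0≤1/1+ n ⊡ proj₂ E n))
                  where
                    r≤b : abs r ≤ ι b
                    r≤b = ≤-trans (≤-reflexive (0≤p⇒∣p∣≡p 0≤r)) (≤-trans r≤ℓ (≤-trans (p≤∣p∣ (ℓ n)) ℓ≤b))

-- log x = max (log x) 0 - max (log x⁻¹) 0
log : (x : ℝ) → 0ℝ <ℝ x → ℝ
log x 0<x = log⁺ x -ℝ log⁺ (x ⁻¹[ 0<x ])

odds-positive : ∀ ε (0<ε : 0ℝ <ℝ ε) → ε <ℝ ½ℝ → 0ℝ <ℝ (1ℝ -ℝ ε) *ℝ ε ⁻¹[ 0<ε ]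
odds-positive ε 0<ε ε<½ =
  *ℝ-positive {1ℝ -ℝ ε} {ε ⁻¹[ 0<ε ]} (1-ε-positive {ε} ε<½) (⁻¹-positive {ε} 0<ε)

record Digraph (n : ℕ) : Set where
  field
    outNeighbours : Fin n → Subset n
    loopless      : ∀ v → v ∉ outNeighbours v
open Digraph public

outdegree : ∀ {n} → Digraph n → Fin n → ℕ
outdegree G v = ∣ outNeighbours G v ∣

MinOutdegreeAtLeast : ∀ {n} → Digraph n → ℝ → Set
MinOutdegreeAtLeast G d = ∀ v → d ≤ℝ fromℕ (outdegree G v)

Stable : ∀ {n} → Digraph n → Subset n → Set
Stable G T = ∀ v → v ∈ T → 2 ℕ.* ∣ outNeighbours G v ∩ T ∣ ℕ.≤ outdegree G v

{-# OPTIONS --safe #-}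
-- Pick S ⊆ V at random, each vertex with probability p = (1 − ε)/2, and keep the
-- vertices of S with at most half of their out-neighbours in S; the kept set is
-- stable.  A Chernoff bound with tilt t = 1/(1 − ε) shows that a vertex of outdegree d has more than half of its
-- out-neighbours in S with probability at most (p t + (1 − p)/t)ᵈ = (1 − ε²/2)ᵈ,
-- and the degree condition makes this at most ε/(1 − ε).  As v ∈ S is independent
-- of that event, the expected size is at least n p (1 − ε/(1 − ε)) = (½ − ε) n.
--
-- All of this is done with rational approximations of ε; the same stable set, one
-- of maximum size among those obtained from some S, serves all of them.
module Submission where

open import Defs
open import Data.Bool.Base using (Bool; true; false; if_then_else_; _∧_)
open import Data.Fin.Base using (Fin; zero; suc)
open import Data.Fin.Subset using (Subset; _∈_; _∉_; _⊆_; _∩_; ∣_∣)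
open import Data.Fin.Subset.Properties using (p⊆q⇒∣p∣≤∣q∣; x∈p∩q⁺; x∈p∩q⁻)
open import Data.Nat.Base as ℕ using (ℕ; zero; suc)
import Data.Nat.Properties as ℕₚ
open import Data.Product.Base using (Σ; ∃; _×_; _,_; proj₁; proj₂)
open import Data.Rational.Base
  using (ℚ; 0ℚ; 1ℚ; ½; _+_; _-_; _*_; -_; _≤_; _<_; nonNegative; positive; +-*-rawSemiring)
  renaming (∣_∣ to abs)
open import Data.Rational.Properties
open import Data.Rational.Solver using (module +-*-Solver)
open import Data.Sum.Base using (inj₁; inj₂)
open import Data.Vec.Base using ([]; _∷_; lookup; tabulate; here; there)
open import Data.Vec.Properties using ([]=⇒lookup; lookup⇒[]=; lookup∘tabulate)
open import Function.Base using (_∘_)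
open import Relation.Binary.PropositionalEquality
open import Relation.Nullary using (¬_; Dec; does; yes; no; contradiction)
open import Algebra.Definitions.RawSemiring +-*-rawSemiring using (_^_; sum)
open +-*-Solver using (solve; _:=_; _:+_; _:*_; _:-_; con)

private variable
  n : ℕ
  p q s t : ℚ

p≤q⇒0≤q-p : p ≤ q → 0ℚ ≤ q - p
p≤q⇒0≤q-p {p} {q} p≤q = by p≤q (solve 2 (λ p q → q :- p :+ p := con 0ℚ :+ q) refl p q)

½≤1 : ½ ≤ 1ℚ
½≤1 = by (<⇒≤ 0<½) refl

-- Powers and truncated exponentials

0≤^ : 0ℚ ≤ q → ∀ d → 0ℚ ≤ q ^ d
0≤^ 0≤q zero    = 0≤1
0≤^ 0≤q (suc d) = 0≤* 0≤q (0≤^ 0≤q d)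

0<^ : 0ℚ < q → ∀ d → 0ℚ < q ^ d
0<^ 0<q zero    = positive⁻¹ 1ℚ
0<^ 0<q (suc d) = 0<* 0<q (0<^ 0<q d)

^-antitone : 0ℚ ≤ q → q ≤ 1ℚ → ∀ {m n} → m ℕ.≤ n → q ^ n ≤ q ^ m
^-antitone 0≤q q≤1 {n = zero}  ℕ.z≤n = ≤-refl
^-antitone {q} 0≤q q≤1 {n = suc n} ℕ.z≤n =
  *-mono 0≤q 0≤1 q≤1 (^-antitone 0≤q q≤1 {n = n} ℕ.z≤n)
^-antitone 0≤q q≤1 (ℕ.s≤s m≤n) = 0≤q ⊡ ^-antitone 0≤q q≤1 m≤n

expSum-decay : ∀ {v} → 0ℚ ≤ q → 0ℚ ≤ v → ∀ m → (1ℚ - v) * expSum (q + v) m ≤ expSum q m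
expSum-decay {q} {v} 0≤q 0≤v m =
  by lip (solve 3 (λ a b v → b :+ (a :- b) := (con 1ℚ :- v) :* a :+ v :* a) refl
            (expSum (q + v) m) (expSum q m) v)
  where
    q≤q+v : q ≤ q + v
    q≤q+v = subst (_≤ q + v) (+-identityʳ q) (≤-refl {q} ⊞ 0≤v)
    ∣v∣ : abs (q + v - q) ≡ v
    ∣v∣ = trans (cong abs (solve 2 (λ q v → q :+ v :- q := v) refl q v)) (0≤p⇒∣p∣≡p 0≤v)
    lip : expSum (q + v) m - expSum q m ≤ v * expSum (q + v) m
    lip = ≤-trans (p≤∣p∣ (expSum (q + v) m - expSum q m))
      (subst (λ z → abs (expSum (q + v) m - expSum q m) ≤ z * expSum (q + v) m) ∣v∣
      (expSum-lipschitz (≤-reflexive (0≤p⇒∣p∣≡p (≤-trans 0≤q q≤q+v)))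
                        (≤-trans (≤-reflexive (0≤p⇒∣p∣≡p 0≤q)) q≤q+v) m))

^*expSum≤1 : ∀ {v} → 0ℚ ≤ v → v ≤ 1ℚ → ∀ d m → (1ℚ - v) ^ d * expSum (ι d * v) m ≤ 1ℚ
^*expSum≤1 {v} 0≤v v≤1 zero m = ≤-reflexive
  (trans (*-identityˡ _) (trans (cong (λ z → expSum z m) (*-zeroˡ v)) (expSum-0 m)))
^*expSum≤1 {v} 0≤v v≤1 (suc d) m = begin
  (1ℚ - v) * (1ℚ - v) ^ d * expSum (ι (suc d) * v) m
    ≡⟨ cong (λ z → (1ℚ - v) * (1ℚ - v) ^ d * expSum z m)
         (trans (cong (_* v) (ι-suc d))
                (solve 2 (λ d v → (d :+ con 1ℚ) :* v := d :* v :+ v) refl (ι d) v)) ⟩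
  (1ℚ - v) * (1ℚ - v) ^ d * expSum (ι d * v + v) m
    ≡⟨ solve 3 (λ a b c → a :* b :* c := b :* (a :* c)) refl (1ℚ - v) ((1ℚ - v) ^ d) _ ⟩
  (1ℚ - v) ^ d * ((1ℚ - v) * expSum (ι d * v + v) m)
    ≤⟨ 0≤^ (p≤q⇒0≤q-p v≤1) d ⊡ expSum-decay (0≤* (0≤ι d) 0≤v) 0≤v m ⟩
  (1ℚ - v) ^ d * expSum (ι d * v) m
    ≤⟨ ^*expSum≤1 0≤v v≤1 d m ⟩
  1ℚ ∎
  where open ≤-Reasoning

-- Expectation over a random subset containing each element with probability p

𝔼 : ℚ → (Subset n → ℚ) → ℚ
𝔼 {zero}  p f = f []
𝔼 {suc n} p f = p * 𝔼 p (f ∘ (true ∷_)) + (1ℚ - p) * 𝔼 p (f ∘ (false ∷_))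

𝔼-cong : {f g : Subset n → ℚ} → (∀ S → f S ≡ g S) → 𝔼 p f ≡ 𝔼 p g
𝔼-cong {zero}      h = h []
𝔼-cong {suc n} {p} h = cong₂ _+_ (cong (p *_) (𝔼-cong (h ∘ (true ∷_))))
                                 (cong ((1ℚ - p) *_) (𝔼-cong (h ∘ (false ∷_))))

𝔼-mono : 0ℚ ≤ p → p ≤ 1ℚ → {f g : Subset n → ℚ} → (∀ S → f S ≤ g S) → 𝔼 p f ≤ 𝔼 p g
𝔼-mono {n = zero}  0≤p p≤1 h = h []
𝔼-mono {n = suc n} 0≤p p≤1 h = (0≤p ⊡ 𝔼-mono 0≤p p≤1 (h ∘ (true ∷_)))
  ⊞ (p≤q⇒0≤q-p p≤1 ⊡ 𝔼-mono 0≤p p≤1 (h ∘ (false ∷_)))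

convex-idem : ∀ p c → p * c + (1ℚ - p) * c ≡ c
convex-idem = solve 2 (λ p c → p :* c :+ (con 1ℚ :- p) :* c := c) refl

𝔼-const : ∀ n p c → 𝔼 {n} p (λ _ → c) ≡ c
𝔼-const zero    p c = refl
𝔼-const (suc n) p c rewrite 𝔼-const n p c = convex-idem p c

𝔼-+ : ∀ n p (f g : Subset n → ℚ) → 𝔼 p (λ S → f S + g S) ≡ 𝔼 p f + 𝔼 p g
𝔼-+ zero    p f g = refl
𝔼-+ (suc n) p f g
  rewrite 𝔼-+ n p (f ∘ (true ∷_)) (g ∘ (true ∷_)) | 𝔼-+ n p (f ∘ (false ∷_)) (g ∘ (false ∷_)) =
  solve 5 (λ p a b c d → p :* (a :+ b) :+ (con 1ℚ :- p) :* (c :+ d)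
                      := (p :* a :+ (con 1ℚ :- p) :* c) :+ (p :* b :+ (con 1ℚ :- p) :* d)) refl
    p (𝔼 p (f ∘ (true ∷_))) (𝔼 p (g ∘ (true ∷_))) (𝔼 p (f ∘ (false ∷_))) (𝔼 p (g ∘ (false ∷_)))

𝔼-sum : ∀ m {n} p (f : Fin m → Subset n → ℚ) →
        𝔼 p (λ S → sum (λ v → f v S)) ≡ sum (λ v → 𝔼 p (f v))
𝔼-sum zero    {n} p f = 𝔼-const n p 0ℚ
𝔼-sum (suc m) {n} p f = trans (𝔼-+ n p (f zero) (λ S → sum (λ v → f (suc v) S)))
                              (cong (𝔼 p (f zero) +_) (𝔼-sum m p (f ∘ suc)))

sum-≥ : ∀ n {c} (f : Fin n → ℚ) → (∀ v → c ≤ f v) → ι n * c ≤ sum f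
sum-≥ zero    {c} f h = ≤-reflexive (*-zeroˡ c)
sum-≥ (suc n) {c} f h = ≤-trans
  (≤-reflexive (trans (cong (_* c) (ι-suc n))
    (solve 2 (λ n c → (n :+ con 1ℚ) :* c := c :+ n :* c) refl (ι n) c)))
  (h zero ⊞ sum-≥ n (f ∘ suc) (h ∘ suc))

⟦_⟧ : Bool → ℚ
⟦ b ⟧ = if b then 1ℚ else 0ℚ

∣tabulate∣ : ∀ n (b : Fin n → Bool) → ι ∣ tabulate b ∣ ≡ sum (λ v → ⟦ b v ⟧)
∣tabulate∣ zero    b = refl
∣tabulate∣ (suc n) b with b zero
... | true  = trans (ι-suc ∣ tabulate (b ∘ suc) ∣)
                (trans (+-comm (ι ∣ tabulate (b ∘ suc) ∣) 1ℚ) (cong (1ℚ +_) (∣tabulate∣ n (b ∘ suc))))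
... | false = trans (∣tabulate∣ n (b ∘ suc)) (sym (+-identityˡ _))

-- The Chernoff bound

-- tilt t s N S = t^∣N ∩ S∣ · s^∣N ∖ S∣
tilt : ℚ → ℚ → Subset n → Subset n → ℚ
tilt t s []          []          = 1ℚ
tilt t s (false ∷ N) (_ ∷ S)     = tilt t s N S
tilt t s (true ∷ N)  (true ∷ S)  = t * tilt t s N S
tilt t s (true ∷ N)  (false ∷ S) = s * tilt t s N S

0≤tilt : 0ℚ ≤ t → 0ℚ ≤ s → (N S : Subset n) → 0ℚ ≤ tilt t s N S
0≤tilt 0≤t 0≤s []          []          = 0≤1
0≤tilt 0≤t 0≤s (false ∷ N) (_ ∷ S)     = 0≤tilt 0≤t 0≤s N S
0≤tilt 0≤t 0≤s (true ∷ N)  (true ∷ S)  = 0≤* 0≤t (0≤tilt 0≤t 0≤s N S)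
0≤tilt 0≤t 0≤s (true ∷ N)  (false ∷ S) = 0≤* 0≤s (0≤tilt 0≤t 0≤s N S)

tilt-^ : t * s ≡ 1ℚ → (N S : Subset n) →
         tilt t s N S * (s * s) ^ ∣ N ∩ S ∣ ≡ s ^ ∣ N ∣
tilt-^ ts []          []      = refl
tilt-^ ts (false ∷ N) (_ ∷ S) = tilt-^ ts N S
tilt-^ {t} {s} ts (true ∷ N) (true ∷ S) =
  trans (solve 4 (λ t s x y → t :* x :* (s :* s :* y) := t :* s :* (s :* (x :* y))) refl
          t s (tilt t s N S) ((s * s) ^ ∣ N ∩ S ∣))
  (trans (cong₂ (λ y z → y * (s * z)) ts (tilt-^ ts N S)) (*-identityˡ _))
tilt-^ {t} {s} ts (true ∷ N) (false ∷ S) =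
  trans (*-assoc s (tilt t s N S) _) (cong (s *_) (tilt-^ ts N S))

^-square : ∀ s k → (s * s) ^ k ≡ s ^ (2 ℕ.* k)
^-square s zero    = refl
^-square s (suc k) = trans (*-assoc s s ((s * s) ^ k))
  (cong (s *_) (trans (cong (s *_) (^-square s k)) (cong (s ^_) (sym (ℕₚ.+-suc k (k ℕ.+ 0))))))

1≤tilt : 0ℚ < s → s ≤ 1ℚ → t * s ≡ 1ℚ → (N S : Subset n) →
         ∣ N ∣ ℕ.≤ 2 ℕ.* ∣ N ∩ S ∣ → 1ℚ ≤ tilt t s N S
1≤tilt {s} {t} 0<s s≤1 ts N S h =
  *-cancelʳ-≤-pos ((s * s) ^ k) {{positive (0<^ (0<* 0<s 0<s) k)}} (begin
    1ℚ * (s * s) ^ k           ≡⟨ trans (*-identityˡ _) (^-square s k) ⟩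
    s ^ (2 ℕ.* k)              ≤⟨ ^-antitone (<⇒≤ 0<s) s≤1 h ⟩
    s ^ ∣ N ∣                  ≡⟨ tilt-^ ts N S ⟨
    tilt t s N S * (s * s) ^ k ∎)
  where
    open ≤-Reasoning
    k = ∣ N ∩ S ∣

𝔼-tilt : ∀ p t s α β (N : Subset n) →
  𝔼 p (λ S → α - β * tilt t s N S) ≡ α - β * (p * t + (1ℚ - p) * s) ^ ∣ N ∣
𝔼-tilt p t s α β []          = refl
𝔼-tilt p t s α β (false ∷ N) rewrite 𝔼-tilt p t s α β N = convex-idem p _
𝔼-tilt p t s α β (true ∷ N)  = trans
  (cong₂ (λ x y → p * x + (1ℚ - p) * y)
    (trans (𝔼-cong (λ S → cong (λ z → α - z) (sym (*-assoc β t (tilt t s N S))))) (𝔼-tilt p t s α (β * t) N))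
    (trans (𝔼-cong (λ S → cong (λ z → α - z) (sym (*-assoc β s (tilt t s N S))))) (𝔼-tilt p t s α (β * s) N)))
  (solve 6 (λ p t s α β A → p :* (α :- β :* t :* A) :+ (con 1ℚ :- p) :* (α :- β :* s :* A)
                          := α :- β :* ((p :* t :+ (con 1ℚ :- p) :* s) :* A)) refl
    p t s α β ((p * t + (1ℚ - p) * s) ^ ∣ N ∣))

𝔼-∈-tilt : ∀ p t s α β (v : Fin n) (N : Subset n) → v ∉ N →
  𝔼 p (λ S → ⟦ lookup S v ⟧ * (α - β * tilt t s N S))
    ≡ p * (α - β * (p * t + (1ℚ - p) * s) ^ ∣ N ∣)
𝔼-∈-tilt p t s α β zero    (true ∷ N)  v∉N = contradiction here v∉N
𝔼-∈-tilt {suc n} p t s α β zero (false ∷ N) v∉N = trans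
  (cong₂ (λ x y → p * x + (1ℚ - p) * y)
    (trans (𝔼-cong (λ S → *-identityˡ (α - β * tilt t s N S))) (𝔼-tilt p t s α β N))
    (trans (𝔼-cong (λ S → *-zeroˡ (α - β * tilt t s N S))) (𝔼-const n p 0ℚ)))
  (solve 2 (λ p x → p :* x :+ (con 1ℚ :- p) :* con 0ℚ := p :* x) refl p _)
𝔼-∈-tilt p t s α β (suc v) (false ∷ N) v∉N
  rewrite 𝔼-∈-tilt p t s α β v N (v∉N ∘ there) = convex-idem p _
𝔼-∈-tilt p t s α β (suc v) (true ∷ N)  v∉N = trans
  (cong₂ (λ x y → p * x + (1ℚ - p) * y) (scaled t) (scaled s))
  (solve 6 (λ p t s α β A → p :* (p :* (α :- β :* t :* A)) :+ (con 1ℚ :- p) :* (p :* (α :- β :* s :* A))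
                          := p :* (α :- β :* ((p :* t :+ (con 1ℚ :- p) :* s) :* A))) refl
    p t s α β ((p * t + (1ℚ - p) * s) ^ ∣ N ∣))
  where
    scaled : ∀ r → 𝔼 p (λ S → ⟦ lookup S v ⟧ * (α - β * (r * tilt t s N S)))
                 ≡ p * (α - β * r * (p * t + (1ℚ - p) * s) ^ ∣ N ∣)
    scaled r = trans
      (𝔼-cong (λ S → cong (λ z → ⟦ lookup S v ⟧ * (α - z)) (sym (*-assoc β r (tilt t s N S)))))
      (𝔼-∈-tilt p t s α (β * r) v N (v∉N ∘ there))

-- Stable sets

keeps : Digraph n → Subset n → Fin n → Bool
keeps G S v = lookup S v ∧ does (2 ℕ.* ∣ outNeighbours G v ∩ S ∣ ℕₚ.≤? outdegree G v)

kept : Digraph n → Subset n → Subset n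
kept G S = tabulate (keeps G S)

∧-true : ∀ a {b} → a ∧ b ≡ true → a ≡ true × b ≡ true
∧-true true e = refl , e

kept-∈ : (G : Digraph n) (S : Subset n) → ∀ {v} → v ∈ kept G S →
         v ∈ S × 2 ℕ.* ∣ outNeighbours G v ∩ S ∣ ℕ.≤ outdegree G v
kept-∈ G S {v} v∈T
  with ∧-true (lookup S v) (trans (sym (lookup∘tabulate (keeps G S) v)) ([]=⇒lookup v∈T))
... | e , e′ = lookup⇒[]= v S e , does-true (_ ℕₚ.≤? _) e′

kept-stable : (G : Digraph n) (S : Subset n) → Stable G (kept G S)
kept-stable G S v v∈T = ℕₚ.≤-trans
  (ℕₚ.*-monoʳ-≤ 2 (p⊆q⇒∣p∣≤∣q∣ N∩T⊆N∩S))
  (proj₂ (kept-∈ G S v∈T))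
  where
    N∩T⊆N∩S : outNeighbours G v ∩ kept G S ⊆ outNeighbours G v ∩ S
    N∩T⊆N∩S u∈ = let (u∈N , u∈T) = x∈p∩q⁻ _ _ u∈ in x∈p∩q⁺ (u∈N , proj₁ (kept-∈ G S u∈T))

∧-≥ : ∀ {x} {A : Set} b (A? : Dec A) → 0ℚ ≤ x → (¬ A → 1ℚ ≤ x) →
      ⟦ b ⟧ * (1ℚ - 1ℚ * x) ≤ ⟦ b ∧ does A? ⟧
∧-≥ {x} false A?      0≤x 1≤x = ≤-reflexive (*-zeroˡ (1ℚ - 1ℚ * x))
∧-≥ {x} true  (yes _) 0≤x 1≤x = by 0≤x
  (solve 1 (λ x → con 1ℚ :+ con 0ℚ := con 1ℚ :* (con 1ℚ :- con 1ℚ :* x) :+ x) refl x)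
∧-≥ {x} true  (no ¬a) 0≤x 1≤x = by (1≤x ¬a)
  (solve 1 (λ x → con 0ℚ :+ con 1ℚ := con 1ℚ :* (con 1ℚ :- con 1ℚ :* x) :+ x) refl x)

keeps-≥ : 0ℚ < s → s ≤ 1ℚ → 0ℚ ≤ t → t * s ≡ 1ℚ → (G : Digraph n) (S : Subset n) → ∀ v →
          ⟦ lookup S v ⟧ * (1ℚ - 1ℚ * tilt t s (outNeighbours G v) S) ≤ ⟦ keeps G S v ⟧
keeps-≥ 0<s s≤1 0≤t ts G S v =
  ∧-≥ (lookup S v) (2 ℕ.* ∣ outNeighbours G v ∩ S ∣ ℕₚ.≤? outdegree G v)
    (0≤tilt 0≤t (<⇒≤ 0<s) (outNeighbours G v) S)
    (λ ¬h → 1≤tilt 0<s s≤1 ts (outNeighbours G v) S (ℕₚ.<⇒≤ (ℕₚ.≰⇒> ¬h)))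

argmax : (f : Subset n → ℕ) → ∃ λ S → ∀ S′ → f S′ ℕ.≤ f S
argmax {zero}  f = [] , λ { [] → ℕₚ.≤-refl }
argmax {suc n} f with argmax (f ∘ (true ∷_)) | argmax (f ∘ (false ∷_))
... | A , hA | B , hB with ℕₚ.≤-total (f (true ∷ A)) (f (false ∷ B))
... | inj₁ A≤B = false ∷ B , λ { (true ∷ S) → ℕₚ.≤-trans (hA S) A≤B ; (false ∷ S) → hB S }
... | inj₂ B≤A = true ∷ A  , λ { (true ∷ S) → hA S ; (false ∷ S) → ℕₚ.≤-trans (hB S) B≤A }

kept-size : ∀ {e M} → 0ℚ < e → e < 1ℚ → (G : Digraph n) → (∀ S → ∣ kept G S ∣ ℕ.≤ M) →
  (∀ v → (1ℚ - e) * (1ℚ - ½ * (e * e)) ^ outdegree G v ≤ e) →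
  (½ - e) * ι n ≤ ι M
kept-size {n} {e} {M} 0<e e<1 G ≤M small = begin
  (½ - e) * ι n
    ≡⟨ *-comm (½ - e) (ι n) ⟩
  ι n * (½ - e)
    ≤⟨ sum-≥ n (λ v → 𝔼 ρ (λ S → ⟦ keeps G S v ⟧)) likely ⟩
  sum (λ v → 𝔼 ρ (λ S → ⟦ keeps G S v ⟧))
    ≡⟨ 𝔼-sum n ρ (λ v S → ⟦ keeps G S v ⟧) ⟨
  𝔼 ρ (λ S → sum (λ v → ⟦ keeps G S v ⟧))
    ≤⟨ 𝔼-mono 0≤ρ ρ≤1 (λ S → ≤-trans (≤-reflexive (sym (∣tabulate∣ n (keeps G S)))) (ι-mono (≤M S))) ⟩
  𝔼 {n} ρ (λ _ → ι M)
    ≡⟨ 𝔼-const n ρ (ι M) ⟩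
  ι M ∎
  where
    open ≤-Reasoning
    σ = 1ℚ - e
    τ = recip σ
    ρ = ½ * σ
    0<σ : 0ℚ < σ
    0<σ = subst (_< σ) (+-inverseʳ e) (+-monoˡ-< (- e) e<1)
    σ≤1 : σ ≤ 1ℚ
    σ≤1 = by (<⇒≤ 0<e) (solve 1 (λ e → con 1ℚ :+ con 0ℚ := con 1ℚ :- e :+ e) refl e)
    0≤ρ : 0ℚ ≤ ρ
    0≤ρ = <⇒≤ (0<½* 0<σ)
    ρ≤1 : ρ ≤ 1ℚ
    ρ≤1 = *-mono (<⇒≤ 0<½) 0≤1 ½≤1 σ≤1
    τσ : τ * σ ≡ 1ℚ
    τσ = trans (*-comm τ σ) (recip-inverse 0<σ)
    mean : ρ * τ + (1ℚ - ρ) * σ ≡ 1ℚ - ½ * (e * e)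
    mean = trans (solve 2 (λ e r → con ½ :* (con 1ℚ :- e) :* r :+ (con 1ℚ :- con ½ :* (con 1ℚ :- e)) :* (con 1ℚ :- e)
                                 := con ½ :* (r :* (con 1ℚ :- e)) :+ (con ½ :- con ½ :* (e :* e))) refl e τ)
          (trans (cong (λ z → ½ * z + (½ - ½ * (e * e))) τσ)
                 (solve 1 (λ e → con ½ :* con 1ℚ :+ (con ½ :- con ½ :* (e :* e)) := con 1ℚ :- con ½ :* (e :* e)) refl e))
    likely : ∀ v → ½ - e ≤ 𝔼 ρ (λ S → ⟦ keeps G S v ⟧)
    likely v = begin
      ½ - e
        ≤⟨ by (<⇒≤ 0<½ ⊡ small v)
             (solve 2 (λ e A → con ½ :* (con 1ℚ :- e) :* (con 1ℚ :- con 1ℚ :* A) :+ con ½ :* ((con 1ℚ :- e) :* A)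
                             := con ½ :- e :+ con ½ :* e) refl e ((1ℚ - ½ * (e * e)) ^ outdegree G v)) ⟩
      ρ * (1ℚ - 1ℚ * (1ℚ - ½ * (e * e)) ^ outdegree G v)
        ≡⟨ cong (λ a → ρ * (1ℚ - 1ℚ * a ^ outdegree G v)) mean ⟨
      ρ * (1ℚ - 1ℚ * (ρ * τ + (1ℚ - ρ) * σ) ^ outdegree G v)
        ≡⟨ 𝔼-∈-tilt ρ τ σ 1ℚ 1ℚ v (outNeighbours G v) (loopless G v) ⟨
      𝔼 ρ (λ S → ⟦ lookup S v ⟧ * (1ℚ - 1ℚ * tilt τ σ (outNeighbours G v) S))
        ≤⟨ 𝔼-mono 0≤ρ ρ≤1 (λ S → keeps-≥ 0<σ σ≤1 (<⇒≤ (0<recip 0<σ)) τσ G S v) ⟩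
      𝔼 ρ (λ S → ⟦ keeps G S v ⟧) ∎

-- The degree condition

-- l and l′ stand for log⁺ of the odds (1 − e)/e and of their inverse.  The factor
-- 2 − e exceeds the needed 1 by enough to absorb the error terms.
degree-large-enough : ∀ {e c l l′} d m → 0ℚ < e → 0ℚ < c → e + c ≤ ½ → 0ℚ ≤ l →
  (1ℚ - e) * recip e ≤ expSum l m → l′ ≤ ½ * c →
  ι 2 * (recip e * recip e) * (ι 2 - e) * (l - l′) ≤ ι d + c →
  (1ℚ - e) * (1ℚ - ½ * (e * e)) ^ d ≤ e
degree-large-enough {e} {c} {l} {l′} d m 0<e 0<c e+c≤½ 0≤l x≤ l′≤ deg≥ = begin
  (1ℚ - e) * A            ≡⟨ cong (_* A) ex ⟨
  e * x * A               ≡⟨ solve 3 (λ e x A → e :* x :* A := e :* (A :* x)) refl e x A ⟩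
  e * (A * x)             ≤⟨ <⇒≤ 0<e ⊡ (0≤A ⊡ ≤-trans x≤ (expSum-mono 0≤l l≤dv m)) ⟩
  e * (A * expSum (ι d * v) m) ≤⟨ <⇒≤ 0<e ⊡ ^*expSum≤1 0≤v v≤1 d m ⟩
  e * 1ℚ                  ≡⟨ *-identityʳ e ⟩
  e ∎
  where
    open ≤-Reasoning
    r = recip e
    x = (1ℚ - e) * r
    v = ½ * (e * e)
    A = (1ℚ - v) ^ d
    er : e * r ≡ 1ℚ
    er = recip-inverse 0<e
    ex : e * x ≡ 1ℚ - e
    ex = trans (solve 2 (λ e r → e :* ((con 1ℚ :- e) :* r) := e :* r :* (con 1ℚ :- e)) refl e r)
               (trans (cong (_* (1ℚ - e)) er) (*-identityˡ _))
    e≤1 : e ≤ 1ℚ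
    e≤1 = by (e+c≤½ ⊞ (<⇒≤ 0<c ⊞ <⇒≤ 0<½))
      (solve 2 (λ e c → con 1ℚ :+ (e :+ c :+ (con 0ℚ :+ con 0ℚ)) := e :+ (con ½ :+ (c :+ con ½))) refl e c)
    0≤v : 0ℚ ≤ v
    0≤v = 0≤* (<⇒≤ 0<½) (0≤* (<⇒≤ 0<e) (<⇒≤ 0<e))
    v≤1 : v ≤ 1ℚ
    v≤1 = *-mono {b = 1ℚ} {d = 1ℚ} (<⇒≤ 0<½) 0≤1 ½≤1 (*-mono (<⇒≤ 0<e) 0≤1 e≤1 e≤1)
    0≤A : 0ℚ ≤ A
    0≤A = 0≤^ (p≤q⇒0≤q-p v≤1) d
    x[1-l]≤1 : l ≤ 1ℚ → (1ℚ - l) * x ≤ 1ℚ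
    x[1-l]≤1 l≤1 = begin
      (1ℚ - l) * x                 ≤⟨ p≤q⇒0≤q-p l≤1 ⊡ x≤ ⟩
      (1ℚ - l) * expSum l m        ≡⟨ cong (λ z → (1ℚ - l) * expSum z m) (+-identityˡ l) ⟨
      (1ℚ - l) * expSum (0ℚ + l) m ≤⟨ expSum-decay ≤-refl 0≤l m ⟩
      expSum 0ℚ m                  ≡⟨ expSum-0 m ⟩
      1ℚ ∎
    1-2e≤ : 1ℚ - (e + e) ≤ (1ℚ - e) * l
    1-2e≤ with ≤-total l 1ℚ
    ... | inj₁ l≤1 = by (<⇒≤ 0<e ⊡ x[1-l]≤1 l≤1)
      (trans (solve 3 (λ e l x → (con 1ℚ :- e) :* l :+ e :* ((con 1ℚ :- l) :* x)
                               := (con 1ℚ :- e) :* l :+ (con 1ℚ :- l) :* (e :* x)) refl e l x)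
      (trans (cong (λ z → (1ℚ - e) * l + (1ℚ - l) * z) ex)
        (solve 2 (λ e l → (con 1ℚ :- e) :* l :+ (con 1ℚ :- l) :* (con 1ℚ :- e)
                        := con 1ℚ :- (e :+ e) :+ e :* con 1ℚ) refl e l)))
    ... | inj₂ 1≤l = by ((p≤q⇒0≤q-p e≤1 ⊡ 1≤l) ⊞ <⇒≤ 0<e)
      (solve 2 (λ e l → (con 1ℚ :- e) :* l :+ ((con 1ℚ :- e) :* con 1ℚ :+ con 0ℚ)
                      := con 1ℚ :- (e :+ e) :+ ((con 1ℚ :- e) :* l :+ e)) refl e l)
    scaled : (ι 2 - e) * (l - l′) ≤ v * (ι d + c)
    scaled = subst (_≤ v * (ι d + c))
      (trans (solve 4 (λ e r y z → con ½ :* (e :* e) :* (con (ι 2) :* (r :* r) :* y :* z)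
                                 := (e :* r) :* (e :* r) :* (y :* z)) refl e r (ι 2 - e) (l - l′))
        (trans (cong (λ z → z * z * ((ι 2 - e) * (l - l′))) er) (*-identityˡ _)))
      (0≤v ⊡ deg≥)
    0≤2-e : 0ℚ ≤ ι 2 - e
    0≤2-e = by (e≤1 ⊞ 0≤1) (solve 1 (λ e → con (ι 2) :- e :+ (e :+ con 0ℚ) := con 0ℚ :+ (con 1ℚ :+ con 1ℚ)) refl e)
    l≤dv : l ≤ ι d * v
    l≤dv = by (scaled ⊞ ((0≤2-e ⊡ l′≤) ⊞ (1-2e≤ ⊞ ((<⇒≤ 0<c ⊡ v≤1) ⊞ (e+c≤½ ⊞ (e+c≤½ ⊞ 0≤* (<⇒≤ 0<e) (<⇒≤ 0<½c)))))))
      (solve 6 (λ e c l k d v →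
          d :* v :+ ((con (ι 2) :- e) :* (l :- k) :+ ((con (ι 2) :- e) :* k :+
            (con 1ℚ :- (e :+ e) :+ (c :* v :+ (e :+ c :+ (e :+ c :+ con 0ℚ))))))
          := l :+ (v :* (d :+ c) :+ ((con (ι 2) :- e) :* (con ½ :* c) :+
            ((con 1ℚ :- e) :* l :+ (c :* con 1ℚ :+ (con ½ :+ (con ½ :+ e :* (con ½ :* c))))))))
        refl e c l l′ (ι d) v)
      where 0<½c = 0<½* 0<c

-- Limits

eventually-∀ : ∀ n {P : Fin n → ℕ → Set} → (∀ v → Eventually (P v)) → Eventually (λ k → ∀ v → P v k)
eventually-∀ zero    h = 0 , λ _ _ ()
eventually-∀ (suc n) h = eventually₂ (λ { _ a b zero → a ; _ a b (suc v) → b v })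
                                     (h zero) (eventually-∀ n (h ∘ suc))

recip≤1 : 1ℚ ≤ p → recip p ≤ 1ℚ
recip≤1 {p} 1≤p = subst₂ _≤_ (*-identityʳ (recip p)) (trans (*-comm _ p) (recip-inverse 0<p))
  (<⇒≤ (0<recip 0<p) ⊡ 1≤p)
  where 0<p = <-≤-trans (positive⁻¹ 1ℚ) 1≤p

1≤odds : ∀ {e} → 0ℚ < e → e ≤ ½ → 1ℚ ≤ (1ℚ - e) * recip e
1≤odds {e} 0<e e≤½ = subst (_≤ (1ℚ - e) * recip e) (recip-inverse 0<e)
  (*-monoʳ-≤-nonNeg (recip e) {{nonNegative (<⇒≤ (0<recip 0<e))}} {e} {1ℚ - e}
    (by (e≤½ ⊞ e≤½) (solve 1 (λ e → con 1ℚ :- e :+ (e :+ e) := e :+ (con ½ :+ con ½)) refl e)))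

proposition8 : (ε : ℝ) (0<ε : 0ℝ <ℝ ε) (ε<½ : ε <ℝ ½ℝ) →
    (n : ℕ) (G : Digraph n) →
    MinOutdegreeAtLeast G
    (fromℕ 2 *ℝ (ε ⁻¹[ 0<ε ] *ℝ ε ⁻¹[ 0<ε ]) *ℝ (fromℕ 2 -ℝ ε)
    *ℝ log ((1ℝ -ℝ ε) *ℝ ε ⁻¹[ 0<ε ]) (odds-positive ε 0<ε ε<½)) →
    Σ (Subset n) λ T → Stable G T × (½ℝ -ℝ ε) *ℝ fromℕ n ≤ℝ fromℕ ∣ T ∣
proposition8 ε 0<ε ε<½@(c , 0<c , ε+c≤½) n G deg =
  kept G S , kept-stable G S , λ δ 0<δ → eventually₂
    (λ k (0<e , e+c≤½) (l′≤ , deg≥) → ≤-trans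
      (kept-size 0<e (<-≤-trans (e<½ e+c≤½) ½≤1) G S-max (λ v →
        degree-large-enough (outdegree G v) (suc k) 0<e 0<c e+c≤½ (0≤log⁺ℚ (seq odds k) k)
          (<⇒≤ (log⁺ℚ-exceeds (seq odds k) k)) l′≤ (deg≥ v)))
      (p≤p+δ 0<δ))
    ε-range
    (eventually₂ (λ _ → _,_) l′-small (eventually-∀ n (λ v → deg v c 0<c)))
  where
    S = proj₁ (argmax (λ S → ∣ kept G S ∣))
    S-max = proj₂ (argmax (λ S → ∣ kept G S ∣))
    odds = (1ℝ -ℝ ε) *ℝ ε ⁻¹[ 0<ε ]
    odds⁻¹ = odds ⁻¹[ odds-positive ε 0<ε ε<½ ]
    p≤p+δ : ∀ {p δ} → 0ℚ < δ → p ≤ p + δ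
    p≤p+δ {p} 0<δ = subst (_≤ p + _) (+-identityʳ p) (≤-refl {p} ⊞ <⇒≤ 0<δ)
    e<½ : ∀ {e} → e + c ≤ ½ → e < ½
    e<½ {e} h = <-≤-trans (subst (_< e + c) (+-identityʳ e) (+-monoʳ-< e 0<c)) h
    ε-range : Eventually λ k → 0ℚ < seq ε k × seq ε k + c ≤ ½
    ε-range = let (_ , 0<b , b≤) = positive-bound {ε} 0<ε in
      eventually₂ (λ _ b≤e h → <-≤-trans 0<b b≤e , h) b≤ ε+c≤½
    odds⁻¹≤1 : odds⁻¹ ≤ℝ 1ℝ
    odds⁻¹≤1 δ 0<δ = let (N , h) = ε-range in N , λ k N≤k →
      let (0<e , e+c≤½) = h k N≤k
      in ≤-trans (recip≤1 (1≤odds 0<e (<⇒≤ (e<½ e+c≤½)))) (p≤p+δ 0<δ)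
    l′-small : Eventually λ k → seq (log⁺ odds⁻¹) k ≤ ½ * c
    l′-small = let (N , h) = proj₁ (log⁺-nonpositive odds⁻¹ odds⁻¹≤1) (½ * c) (0<½* 0<c) in
      N , λ k N≤k → subst (_ ≤_) (+-identityˡ (½ * c)) (h k N≤k)
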